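{- Let $p>7408848$ be a prime and let $P\in\mathbb{F}_p[x]$ be a polynomial of degree $\frac{p-1}{2}$ with $\sum_{x\in\mathbb{F}_p}P(x)=p$ (values regarded as integers in $\{0,\dots,p-1\}$, sum in $\mathbb{Z}$). Then the leading coefficient of $P$ is one of $1,-1,\frac{p-1}{2},-\frac{p-1}{2}$ (as elements of $\mathbb{F}_p$).
   Context: Elements of $\mathbb{F}_p$ are identified with the integers $\{0,1,\dots,p-1\}$. -}

module Defs where

open import Data.Nat using (ℕ; zero; suc; _+_; _*_; _^_; _%_; NonZero)
open import Data.Fin using (Fin; toℕ)
open import Data.List using (List; map; upTo)
open import Data.Nat.ListAction using (sum)
open import Data.Fin using (zero; suc)

-- A polynomial over F_p of formal degree ≤ d is given by its coefficient
-- vector  c : Fin (suc d) → ℕ,  c i being the coefficient of x^i,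
-- with every coefficient a representative in {0,…,p-1}.

evalℕ : ∀ {d} → (Fin (suc d) → ℕ) → ℕ → ℕ
evalℕ {d} c x = go c
  where
  go : ∀ {m} → (Fin m → ℕ) → ℕ
  go {zero} f = 0
  go {suc m} f = f zero + go (λ i → f (suc i)) * x

evalMod : (p : ℕ) .{{_ : NonZero p}} → ∀ {d} → (Fin (suc d) → ℕ) → ℕ → ℕ
evalMod p c x = evalℕ c x % p

valueSum : (p : ℕ) .{{_ : NonZero p}} → ∀ {d} → (Fin (suc d) → ℕ) → ℕ
valueSum p c = sum (map (evalMod p c) (upTo p))

{-# OPTIONS --safe #-}
-- Write p = 2 d + 1, let n(x) be the value of P at x and put F = ∏ (X − x)^n(x), which is monic of
-- degree ∑ n(x) = p.  By Lagrange interpolation P = (X − Xᵖ) F′ / F.  Since the derivative of Xᵖ is 0,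
-- comparing coefficients in (X − Xᵖ) F′ = P F shows that F′ has degree d and leading coefficient −a,
-- and that H = F + X − Xᵖ has degree d + 1.  Now H F′ = F (F′ + P) has degree p, so F′ + P is a
-- constant k, and comparing top coefficients gives k = 2 a².  Hence P H = k (X − Xᵖ); differentiating
-- this twice and eliminating P shows that H divides (2 k − 1) (k − 2) P′, which has smaller degree than
-- H.  So (2 k − 1) (k − 2) = 0, that is, (4 a² − 1) (a² − 1) = 0.
module Submission where

open import Defs
open import Algebra.Bundles using (CommutativeRing)
import Algebra.Properties.Ring
import Algebra.Solver.Ring
open import Algebra.Solver.Ring.AlmostCommutativeRing
  using (fromCommutativeRing; _-Raw-AlmostCommutative⟶_)
open import Data.Fin using (Fin; fromℕ; zero; suc)
open import Data.Integer using (ℤ; +_; 0ℤ; 1ℤ)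
open import Data.Integer.Divisibility.Signed
  using (_∣_; divides; ∣⇒∣ᵤ; ∣ᵤ⇒∣; ∣m∣n⇒∣m+n; ∣m⇒∣-m; ∣n⇒∣m*n; ∣m⇒∣m*n; ∣-refl)
import Data.Integer.Properties as ℤₚ
open import Data.Integer.Tactic.RingSolver using (solve-∀)
open import Data.List using (List; []; _∷_; _++_; _∷ʳ_; length; map; replicate; upTo)
open import Data.List.Properties using (length-++; length-replicate; map-++; upTo-∷ʳ)
open import Data.Maybe using (Maybe; just; nothing)
open import Data.Nat as ℕ using (ℕ; zero; suc; _∸_; _/_; _%_; _≤_; _<_; z≤n; s≤s)
open import Data.Nat.Combinatorics
  using (_C_; nC1≡n; nCn≡1; nCk≡nC[n∸k]; k>n⇒nCk≡0; nCk+nC[k+1]≡[n+1]C[k+1])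
import Data.Nat.Divisibility as ℕᵈ
open import Data.Nat.DivMod using (m≡m%n+[m/n]*n; m%n<n)
open import Data.Nat.ListAction using (sum)
open import Data.Nat.ListAction.Properties using (sum-++)
open import Data.Nat.Primality using (Prime; euclidsLemma; prime⇒irreducible; prime⇒nonZero)
import Data.Nat.Properties as ℕₚ
open import Data.Nat.Tactic.RingSolver using () renaming (solve-∀ to ℕ-solve-∀)
open import Data.Product using (_,_)
open import Data.Sum as Sum using (_⊎_; inj₁; inj₂)
open import Function using (_∘_)
open import Level using (0ℓ)
open import Relation.Binary.Definitions using (tri<; tri≈; tri>)
open import Relation.Binary.PropositionalEquality as ≡ using (_≡_; _≢_)
import Relation.Binary.Reasoning.Setoid as SetoidReasoning
open import Relation.Nullary using (¬_; yes; no; contradiction)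

-- The interpolating polynomial is built as a sum of n(x) Lagrange polynomials and is matched with
-- the given one through moments: its coefficient at X^j, for 0 < j < p, is -∑ n(x) x^(p-1-j), while
-- ∑ x^m is 0 modulo p for m < p-1 and -1 for m = p-1. Only the coefficients from index d upwards
-- are ever compared. The condition on the sum of values makes deg F equal to p exactly, so that Xᵖ
-- cancels in H. The choice deg P = d balances the degrees: deg H + deg F′ = (d+1) + d = deg F,
-- which is what forces the cofactor F′ + P to be constant. The factor 2 in k = 2 a² is the inverse
-- of d + 1 modulo p: it enters because (d+1) times the top coefficient of H is the top coefficient
-- of F′. The elimination rests on (3P - 2(k+1))(3P - (k+1)) = 9(P-1)(P-k) + (2k-1)(k-2), which is
-- where the constants 3 and 9 come from. No polynomial division is carried out. Divisibility is
-- always an explicit product, and conclusions about the cofactor are drawn from degrees alone.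

-- Identities in a commutative ring with a derivation

record IsDerivation (A : CommutativeRing 0ℓ 0ℓ)
  (∂ : CommutativeRing.Carrier A → CommutativeRing.Carrier A) : Set where
  open CommutativeRing A
  field
    ∂-cong : ∀ {x y} → x ≈ y → ∂ x ≈ ∂ y
    ∂-+    : ∀ x y → ∂ (x + y) ≈ ∂ x + ∂ y
    ∂-neg  : ∀ x → ∂ (- x) ≈ - ∂ x
    ∂-*    : ∀ x y → ∂ (x * y) ≈ ∂ x * y + x * ∂ y
    ∂-1    : ∂ 1# ≈ 0#

module DifferentialRing
  (A : CommutativeRing 0ℓ 0ℓ)
  (ι : CommutativeRing.rawRing ℤₚ.+-*-commutativeRing -Raw-AlmostCommutative⟶ fromCommutativeRing A)
  (∂ : CommutativeRing.Carrier A → CommutativeRing.Carrier A)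
  (isDerivation : IsDerivation A ∂)
  where

  open CommutativeRing A hiding (zero)
  open IsDerivation isDerivation
  open _-Raw-AlmostCommutative⟶_ ι using (⟦_⟧)
  open SetoidReasoning setoid

  private
    coefficient≟ : ∀ x y → Maybe (⟦ x ⟧ ≈ ⟦ y ⟧)
    coefficient≟ x y with x ℤₚ.≟ y
    ... | yes ≡.refl = just refl
    ... | no _       = nothing

    module Solver = Algebra.Solver.Ring
      (CommutativeRing.rawRing ℤₚ.+-*-commutativeRing) (fromCommutativeRing A) ι coefficient≟
  open Solver using (solve; _:=_; _:+_; _:*_; _:-_; :-_; con)

  -- The logarithmic derivative is additive over products: S L′/L = B is added to S F′/F = P, with
  -- denominators cleared.
  product-log-derivative : ∀ S L B F P → L * B ≈ S → ∂ L ≈ 1# → S * ∂ F ≈ P * F →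
    S * ∂ (L * F) ≈ (B + P) * (L * F)
  product-log-derivative S L B F P L*B≈S ∂L≈1 log-derivative = begin
    S * ∂ (L * F)                ≈⟨ *-congˡ (∂-* L F) ⟩
    S * (∂ L * F + L * ∂ F)      ≈⟨ *-congˡ (+-congʳ (trans (*-congʳ ∂L≈1) (*-identityˡ F))) ⟩
    S * (F + L * ∂ F)
      ≈⟨ solve 4 (λ S F L F′ → S :* (F :+ L :* F′) := S :* F :+ L :* (S :* F′)) refl S F L (∂ F) ⟩
    S * F + L * (S * ∂ F)        ≈⟨ +-cong (*-congʳ (sym L*B≈S)) (*-congˡ log-derivative) ⟩
    L * B * F + L * (P * F)
      ≈⟨ solve 4 (λ L B F P → L :* B :* F :+ L :* (P :* F) := (B :+ P) :* (L :* F)) refl L B F P ⟩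
    (B + P) * (L * F)            ∎

  module _ (S F P : Carrier) (log-derivative : S * ∂ F ≈ P * F) where

    -- Exhibits H F′ as a multiple of F; comparing degrees in this equation later shows that the
    -- cofactor is constant.
    shifted-derivative : (F + S) * ∂ F ≈ F * (∂ F + P)
    shifted-derivative = begin
      (F + S) * ∂ F     ≈⟨ distribʳ (∂ F) F S ⟩
      F * ∂ F + S * ∂ F ≈⟨ +-congˡ log-derivative ⟩
      F * ∂ F + P * F   ≈⟨ solve 3 (λ F G P → F :* G :+ P :* F := F :* (G :+ P)) refl F (∂ F) P ⟩
      F * (∂ F + P)     ∎

    module _ (c : Carrier) (∂S≈1 : ∂ S ≈ 1#) (∂c≈0 : ∂ c ≈ 0#) (∂F+P≈c : ∂ F + P ≈ c) where

      private
        H W : Carrier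
        H = F + S
        W = c - P + 1#

        P*H : P * H ≈ c * S
        P*H = begin
          P * (F + S)      ≈⟨ distribˡ P F S ⟩
          P * F + P * S    ≈⟨ +-congʳ (sym log-derivative) ⟩
          S * ∂ F + P * S  ≈⟨ solve 3 (λ S G P → S :* G :+ P :* S := (G :+ P) :* S) refl S (∂ F) P ⟩
          (∂ F + P) * S    ≈⟨ *-congʳ ∂F+P≈c ⟩
          c * S            ∎

        ∂H : ∂ H ≈ W
        ∂H = begin
          ∂ (F + S)          ≈⟨ ∂-+ F S ⟩
          ∂ F + ∂ S          ≈⟨ +-congˡ ∂S≈1 ⟩
          ∂ F + 1#           ≈⟨ solve 3 (λ G P o → G :+ o := G :+ P :- P :+ o) refl (∂ F) P 1# ⟩
          ∂ F + P - P + 1#   ≈⟨ +-congʳ (+-congʳ ∂F+P≈c) ⟩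
          c - P + 1#         ∎

        ∂W : ∂ W ≈ - ∂ P
        ∂W = begin
          ∂ (c - P + 1#)           ≈⟨ ∂-+ (c - P) 1# ⟩
          ∂ (c - P) + ∂ 1#         ≈⟨ +-cong (∂-+ c (- P)) ∂-1 ⟩
          ∂ c + ∂ (- P) + 0#       ≈⟨ +-identityʳ _ ⟩
          ∂ c + ∂ (- P)            ≈⟨ +-cong ∂c≈0 (∂-neg P) ⟩
          0# - ∂ P                 ≈⟨ +-identityˡ _ ⟩
          - ∂ P                    ∎

        -- The Leibniz rule solved for one term. Taking x = P and then x = P′ turns P H = c S into
        -- its first two derivatives.
        ∂x*H : ∀ x → ∂ x * H ≈ ∂ (x * H) - x * W
        ∂x*H x = begin
          ∂ x * H                   ≈⟨ solve 2 (λ u v → u := u :+ v :- v) refl (∂ x * H) (x * W) ⟩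
          ∂ x * H + x * W - x * W   ≈⟨ +-congʳ (+-congˡ (*-congˡ (sym ∂H))) ⟩
          ∂ x * H + x * ∂ H - x * W ≈⟨ +-congʳ (sym (∂-* x H)) ⟩
          ∂ (x * H) - x * W         ∎

        ∂P*H : ∂ P * H ≈ c - P * W
        ∂P*H = begin
          ∂ P * H                   ≈⟨ ∂x*H P ⟩
          ∂ (P * H) - P * W         ≈⟨ +-congʳ (∂-cong P*H) ⟩
          ∂ (c * S) - P * W         ≈⟨ +-congʳ (∂-* c S) ⟩
          ∂ c * S + c * ∂ S - P * W ≈⟨ +-congʳ (+-cong (*-congʳ ∂c≈0) (*-congˡ ∂S≈1)) ⟩
          0# * S + c * 1# - P * W   ≈⟨ +-congʳ (+-cong (zeroˡ S) (*-identityʳ c)) ⟩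
          0# + c - P * W            ≈⟨ +-congʳ (+-identityˡ c) ⟩
          c - P * W                 ∎

        ∂∂P*H : ∂ (∂ P) * H ≈ P * ∂ P - ∂ P * W - ∂ P * W
        ∂∂P*H = begin
          ∂ (∂ P) * H                           ≈⟨ ∂x*H (∂ P) ⟩
          ∂ (∂ P * H) - ∂ P * W                 ≈⟨ +-congʳ (∂-cong ∂P*H) ⟩
          ∂ (c - P * W) - ∂ P * W               ≈⟨ +-congʳ (∂-+ c (- (P * W))) ⟩
          ∂ c + ∂ (- (P * W)) - ∂ P * W
            ≈⟨ +-congʳ (+-cong ∂c≈0 (trans (∂-neg (P * W)) (-‿cong (∂-* P W)))) ⟩
          0# - (∂ P * W + P * ∂ W) - ∂ P * W    ≈⟨ +-congʳ (+-identityˡ _) ⟩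
          - (∂ P * W + P * ∂ W) - ∂ P * W       ≈⟨ +-congʳ (-‿cong (+-congˡ (*-congˡ ∂W))) ⟩
          - (∂ P * W + P * - ∂ P) - ∂ P * W
            ≈⟨ solve 3 (λ P P′ W → :- (P′ :* W :+ P :* :- P′) :- P′ :* W := P :* P′ :- P′ :* W :- P′ :* W) refl P (∂ P) W ⟩
          P * ∂ P - ∂ P * W - ∂ P * W           ∎

      -- Modulo H the first two derivatives of P H = c S read (P − 1) (P − c) = 0 and
      -- P′ (3 P − 2 c − 2) = 0; eliminating P leaves the resultant (2 c − 1) (c − 2) of the two
      -- polynomials in P.
      elimination :
        (F + S) * (∂ (∂ P) * (⟦ + 3 ⟧ * P - (c + 1#)) - ⟦ + 9 ⟧ * (∂ P * ∂ P)) ≈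
        (⟦ + 2 ⟧ * c - 1#) * (c - ⟦ + 2 ⟧) * ∂ P
      elimination = begin
        H * (∂ (∂ P) * L - ⟦ + 9 ⟧ * (∂ P * ∂ P))
          ≈⟨ solve 4 (λ H P″ P′ L → H :* (P″ :* L :- con (+ 9) :* (P′ :* P′))
                                 := (P″ :* H) :* L :- con (+ 9) :* (P′ :* (P′ :* H)))
               refl H (∂ (∂ P)) (∂ P) L ⟩
        ∂ (∂ P) * H * L - ⟦ + 9 ⟧ * (∂ P * (∂ P * H))
          ≈⟨ +-cong (*-congʳ ∂∂P*H) (-‿cong (*-congˡ (*-congˡ ∂P*H))) ⟩
        (P * ∂ P - ∂ P * W - ∂ P * W) * L - ⟦ + 9 ⟧ * (∂ P * (c - P * W))
          -- The solver reads `con 1ℤ` as `⟦ 1ℤ ⟧`, which is only equivalent to `1#`, so the units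
          -- are exchanged before and after its call.
          ≈⟨ +-cong (*-cong (+-cong (+-congˡ (-‿cong (*-congˡ W≈))) (-‿cong (*-congˡ W≈))) L≈)
                    (-‿cong (*-congˡ (*-congˡ (+-congˡ (-‿cong (*-congˡ W≈)))))) ⟩
        (P * ∂ P - ∂ P * W₁ - ∂ P * W₁) * L₁ - ⟦ + 9 ⟧ * (∂ P * (c - P * W₁))
          ≈⟨ solve 3 (λ P P′ c →
               (P :* P′ :- P′ :* (c :- P :+ con 1ℤ) :- P′ :* (c :- P :+ con 1ℤ))
                 :* (con (+ 3) :* P :- (c :+ con 1ℤ))
                 :- con (+ 9) :* (P′ :* (c :- P :* (c :- P :+ con 1ℤ)))
               := (con (+ 2) :* c :- con 1ℤ) :* (c :- con (+ 2)) :* P′)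
             refl P (∂ P) c ⟩
        (⟦ + 2 ⟧ * c - ⟦ 1ℤ ⟧) * (c - ⟦ + 2 ⟧) * ∂ P
          ≈⟨ *-congʳ (*-congʳ (+-congˡ (-‿cong 1-homo))) ⟩
        (⟦ + 2 ⟧ * c - 1#) * (c - ⟦ + 2 ⟧) * ∂ P ∎
        where
        open _-Raw-AlmostCommutative⟶_ ι using (1-homo)
        L L₁ W₁ : Carrier
        L = ⟦ + 3 ⟧ * P - (c + 1#)
        L₁ = ⟦ + 3 ⟧ * P - (c + ⟦ 1ℤ ⟧)
        W₁ = c - P + ⟦ 1ℤ ⟧
        W≈ : W ≈ W₁
        W≈ = +-congˡ (sym 1-homo)
        L≈ : L ≈ L₁
        L≈ = +-congˡ (-‿cong (+-congˡ (sym 1-homo)))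

open import Data.Integer using (_+_; _*_; -_; _-_; _^_; ∣_∣)

-- Integers modulo m and power series over them

module Modular (m : ℕ) where

  infix 4 _≈_

  -- A record rather than a bare divisibility, so that x and y can be inferred from a proof.
  -- Residues remain integers: identities over ℤ carry over by `≈-reflexive`.
  record _≈_ (x y : ℤ) : Set where
    constructor congruent
    field difference : + m ∣ x - y

  open _≈_ public

  private
    via : ∀ {x y z} → z ≡ x - y → + m ∣ z → x ≈ y
    via eq d = congruent (≡.subst (+ m ∣_) eq d)

  ≈-reflexive : ∀ {x y} → x ≡ y → x ≈ y
  ≈-reflexive {x} ≡.refl = congruent (divides 0ℤ (ℤₚ.+-inverseʳ x))

  ≈-sym : ∀ {x y} → x ≈ y → y ≈ x
  ≈-sym {x} {y} e = via (eq x y) (∣m⇒∣-m (difference e))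
    where
    eq : ∀ x y → - (x - y) ≡ y - x
    eq = solve-∀

  ≈-trans : ∀ {x y z} → x ≈ y → y ≈ z → x ≈ z
  ≈-trans {x} {y} {z} e e′ = via (eq x y z) (∣m∣n⇒∣m+n (difference e) (difference e′))
    where
    eq : ∀ x y z → (x - y) + (y - z) ≡ x - z
    eq = solve-∀

  +-cong : ∀ {x y u v} → x ≈ y → u ≈ v → x + u ≈ y + v
  +-cong {x} {y} {u} {v} e e′ = via (eq x y u v) (∣m∣n⇒∣m+n (difference e) (difference e′))
    where
    eq : ∀ x y u v → (x - y) + (u - v) ≡ (x + u) - (y + v)
    eq = solve-∀

  *-cong : ∀ {x y u v} → x ≈ y → u ≈ v → x * u ≈ y * v
  *-cong {x} {y} {u} {v} e e′ =
    via (eq x y u v) (∣m∣n⇒∣m+n (∣m⇒∣m*n u (difference e)) (∣n⇒∣m*n y (difference e′)))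
    where
    eq : ∀ x y u v → (x - y) * u + y * (u - v) ≡ x * u - y * v
    eq = solve-∀

  -‿cong : ∀ {x y} → x ≈ y → - x ≈ - y
  -‿cong {x} {y} e = via (eq x y) (∣m⇒∣-m (difference e))
    where
    eq : ∀ x y → - (x - y) ≡ - x - - y
    eq = solve-∀

  modulus≈0 : + m ≈ 0ℤ
  modulus≈0 = via (≡.sym (ℤₚ.+-identityʳ (+ m))) ∣-refl

  residueRing : CommutativeRing 0ℓ 0ℓ
  residueRing = record
    { Carrier = ℤ ; _≈_ = _≈_ ; _+_ = _+_ ; _*_ = _*_ ; -_ = -_ ; 0# = 0ℤ ; 1# = 1ℤ
    ; isCommutativeRing = record
      { isRing = record
        { +-isAbelianGroup = record
          { isGroup = record
            { isMonoid = record
              { isSemigroup = record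
                { isMagma = record
                  { isEquivalence = record { refl = ≈-reflexive ≡.refl ; sym = ≈-sym ; trans = ≈-trans }
                  ; ∙-cong = +-cong
                  }
                ; assoc = λ x y z → ≈-reflexive (ℤₚ.+-assoc x y z)
                }
              ; identity = (λ x → ≈-reflexive (ℤₚ.+-identityˡ x)) , (λ x → ≈-reflexive (ℤₚ.+-identityʳ x))
              }
            ; inverse = (λ x → ≈-reflexive (ℤₚ.+-inverseˡ x)) , (λ x → ≈-reflexive (ℤₚ.+-inverseʳ x))
            ; ⁻¹-cong = -‿cong
            }
          ; comm = λ x y → ≈-reflexive (ℤₚ.+-comm x y)
          }
        ; *-cong = *-cong
        ; *-assoc = λ x y z → ≈-reflexive (ℤₚ.*-assoc x y z)
        ; *-identity = (λ x → ≈-reflexive (ℤₚ.*-identityˡ x)) , (λ x → ≈-reflexive (ℤₚ.*-identityʳ x))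
        ; distrib = (λ x y z → ≈-reflexive (ℤₚ.*-distribˡ-+ x y z)) , (λ x y z → ≈-reflexive (ℤₚ.*-distribʳ-+ x y z))
        }
      ; *-comm = λ x y → ≈-reflexive (ℤₚ.*-comm x y)
      }
    }

  open CommutativeRing residueRing public using (setoid) renaming (refl to ≈-refl)

  ≈0-+ : ∀ {x y} → x ≈ 0ℤ → y ≈ 0ℤ → x + y ≈ 0ℤ
  ≈0-+ = +-cong

  ≈0-*ˡ : ∀ {x} y → x ≈ 0ℤ → x * y ≈ 0ℤ
  ≈0-*ˡ y e = *-cong {y = 0ℤ} e (≈-refl {y})

  ≈0-*ʳ : ∀ x {y} → y ≈ 0ℤ → x * y ≈ 0ℤ
  ≈0-*ʳ x e = ≈-trans (*-cong (≈-refl {x}) e) (≈-reflexive (ℤₚ.*-zeroʳ x))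

  -- Power series with coefficients modulo m; polynomials are those whose coefficients eventually vanish.
  Series : Set
  Series = ℕ → ℤ

  infix 4 _≋_

  record _≋_ (f g : Series) : Set where
    constructor coefficientwise
    field at : ∀ n → f n ≈ g n

  open _≋_ public

  infixl 6 _⊕_
  infixl 7 _⊛_

  _⊕_ : Series → Series → Series
  (f ⊕ g) n = f n + g n

  ⊖_ : Series → Series
  (⊖ f) n = - f n

  constant : ℤ → Series
  constant x zero    = x
  constant x (suc _) = 0ℤ

  _⊛_ : Series → Series → Series
  (f ⊛ g) zero    = f 0 * g 0
  (f ⊛ g) (suc n) = f 0 * g (suc n) + ((f ∘ suc) ⊛ g) n

  ⊛-cong : ∀ {f f′ g g′} → f ≋ f′ → g ≋ g′ → f ⊛ g ≋ f′ ⊛ g′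
  ⊛-cong {f} {f′} {g} {g′} e e′ = coefficientwise (go f f′ (at e))
    where
    go : ∀ f f′ → (∀ n → f n ≈ f′ n) → ∀ n → (f ⊛ g) n ≈ (f′ ⊛ g′) n
    go f f′ e zero    = *-cong (e 0) (at e′ 0)
    go f f′ e (suc n) = +-cong (*-cong (e 0) (at e′ (suc n))) (go (f ∘ suc) (f′ ∘ suc) (e ∘ suc) n)

  ⊛-zeroˡ : ∀ f g → (∀ i → f i ≈ 0ℤ) → ∀ n → (f ⊛ g) n ≈ 0ℤ
  ⊛-zeroˡ f g e zero    = ≈0-*ˡ (g 0) (e 0)
  ⊛-zeroˡ f g e (suc n) = ≈0-+ (≈0-*ˡ (g (suc n)) (e 0)) (⊛-zeroˡ (f ∘ suc) g (e ∘ suc) n)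

  constant-⊛ : ∀ x f n → (constant x ⊛ f) n ≈ x * f n
  constant-⊛ x f zero    = ≈-refl
  constant-⊛ x f (suc n) =
    ≈-trans (+-cong (≈-refl {x * f (suc n)}) (⊛-zeroˡ (λ _ → 0ℤ) f (λ _ → ≈-refl) n))
            (≈-reflexive (ℤₚ.+-identityʳ _))

  ⊛-distribʳ : ∀ h f g n → ((f ⊕ g) ⊛ h) n ≡ (f ⊛ h) n + (g ⊛ h) n
  ⊛-distribʳ h f g zero    = ℤₚ.*-distribʳ-+ (h 0) (f 0) (g 0)
  ⊛-distribʳ h f g (suc n) rewrite ⊛-distribʳ h (f ∘ suc) (g ∘ suc) n =
    eq (f 0) (g 0) (h (suc n)) ((f ∘ suc ⊛ h) n) ((g ∘ suc ⊛ h) n)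
    where
    eq : ∀ a b c u v → (a + b) * c + (u + v) ≡ (a * c + u) + (b * c + v)
    eq = solve-∀

  -- The mirror image of the recursion that defines `_⊛_`, splitting off a coefficient of the right
  -- factor. Commutativity and the Leibniz rule need both forms.
  ⊛-suc : ∀ f g n → (f ⊛ g) (suc n) ≡ f (suc n) * g 0 + (f ⊛ (g ∘ suc)) n
  ⊛-suc f g zero    = ℤₚ.+-comm (f 0 * g 1) (f 1 * g 0)
  ⊛-suc f g (suc n) rewrite ⊛-suc (f ∘ suc) g n =
    eq (f 0 * g (suc (suc n))) (f (suc (suc n)) * g 0) ((f ∘ suc ⊛ g ∘ suc) n)
    where
    eq : ∀ a b c → a + (b + c) ≡ b + (a + c)
    eq = solve-∀

  ⊛-comm : ∀ f g n → (f ⊛ g) n ≡ (g ⊛ f) n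
  ⊛-comm f g zero    = ℤₚ.*-comm (f 0) (g 0)
  ⊛-comm f g (suc n) = ≡.trans
    (≡.cong₂ _+_ (ℤₚ.*-comm (f 0) (g (suc n))) (⊛-comm (f ∘ suc) g n))
    (≡.sym (⊛-suc g f n))

  private
    scale-⊛ : ∀ x f g n → ((λ i → x * f i) ⊛ g) n ≡ x * (f ⊛ g) n
    scale-⊛ x f g zero    = ℤₚ.*-assoc x (f 0) (g 0)
    scale-⊛ x f g (suc n) rewrite scale-⊛ x (f ∘ suc) g n =
      eq x (f 0) (g (suc n)) ((f ∘ suc ⊛ g) n)
      where
      eq : ∀ x a b c → x * a * b + x * c ≡ x * (a * b + c)
      eq = solve-∀

  ⊛-assoc : ∀ f g h n → ((f ⊛ g) ⊛ h) n ≡ (f ⊛ (g ⊛ h)) n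
  ⊛-assoc f g h zero    = ℤₚ.*-assoc (f 0) (g 0) (h 0)
  ⊛-assoc f g h (suc n)
    rewrite ⊛-distribʳ h (λ i → f 0 * g (suc i)) ((f ∘ suc) ⊛ g) n
          | scale-⊛ (f 0) (g ∘ suc) h n
          | ⊛-assoc (f ∘ suc) g h n =
    eq (f 0) (g 0) (h (suc n)) ((g ∘ suc ⊛ h) n) ((f ∘ suc ⊛ (g ⊛ h)) n)
    where
    eq : ∀ a b c u v → a * b * c + (a * u + v) ≡ a * (b * c + u) + v
    eq = solve-∀

  private
    ≡⇒≋ : ∀ {f g : Series} → (∀ n → f n ≡ g n) → f ≋ g
    ≡⇒≋ e = coefficientwise λ n → ≈-reflexive (e n)

    ⊛-identityˡ : ∀ f → constant 1ℤ ⊛ f ≋ f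
    ⊛-identityˡ f = coefficientwise λ n →
      ≈-trans (constant-⊛ 1ℤ f n) (≈-reflexive (ℤₚ.*-identityˡ (f n)))

  constant-0 : ∀ n → constant 0ℤ n ≡ 0ℤ
  constant-0 zero    = ≡.refl
  constant-0 (suc _) = ≡.refl

  ≋-trans : ∀ {f g h} → f ≋ g → g ≋ h → f ≋ h
  ≋-trans e e′ = coefficientwise λ n → ≈-trans (at e n) (at e′ n)

  seriesRing : CommutativeRing 0ℓ 0ℓ
  seriesRing = record
    { Carrier = Series ; _≈_ = _≋_ ; _+_ = _⊕_ ; _*_ = _⊛_ ; -_ = ⊖_ ; 0# = constant 0ℤ ; 1# = constant 1ℤ
    ; isCommutativeRing = record
      { isRing = record
        { +-isAbelianGroup = record
          { isGroup = record
            { isMonoid = record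
              { isSemigroup = record
                { isMagma = record
                  { isEquivalence = record
                    { refl = ≡⇒≋ λ _ → ≡.refl
                    ; sym = λ e → coefficientwise λ n → ≈-sym (at e n)
                    ; trans = ≋-trans
                    }
                  ; ∙-cong = λ e e′ → coefficientwise λ n → +-cong (at e n) (at e′ n)
                  }
                ; assoc = λ f g h → ≡⇒≋ λ n → ℤₚ.+-assoc (f n) (g n) (h n)
                }
              ; identity =
                  (λ f → ≡⇒≋ λ n → ≡.trans (≡.cong (_+ f n) (constant-0 n)) (ℤₚ.+-identityˡ (f n))) ,
                  (λ f → ≡⇒≋ λ n → ≡.trans (≡.cong (λ z → f n + z) (constant-0 n)) (ℤₚ.+-identityʳ (f n)))
              }
            ; inverse =
                (λ f → ≡⇒≋ λ n → ≡.trans (ℤₚ.+-inverseˡ (f n)) (≡.sym (constant-0 n))) ,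
                (λ f → ≡⇒≋ λ n → ≡.trans (ℤₚ.+-inverseʳ (f n)) (≡.sym (constant-0 n)))
            ; ⁻¹-cong = λ e → coefficientwise λ n → -‿cong (at e n)
            }
          ; comm = λ f g → ≡⇒≋ λ n → ℤₚ.+-comm (f n) (g n)
          }
        ; *-cong = ⊛-cong
        ; *-assoc = λ f g h → ≡⇒≋ (⊛-assoc f g h)
        ; *-identity = ⊛-identityˡ , (λ f → ≋-trans (≡⇒≋ (⊛-comm f (constant 1ℤ))) (⊛-identityˡ f))
        ; distrib =
            (λ f g h → ≡⇒≋ λ n → ≡.trans (⊛-comm f (g ⊕ h) n)
              (≡.trans (⊛-distribʳ f g h n) (≡.cong₂ _+_ (⊛-comm g f n) (⊛-comm h f n)))) ,
            (λ f g h → ≡⇒≋ (⊛-distribʳ f g h))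
        }
      ; *-comm = λ f g → ≡⇒≋ (⊛-comm f g)
      }
    }

  ℤ⟶series : CommutativeRing.rawRing ℤₚ.+-*-commutativeRing
    -Raw-AlmostCommutative⟶ fromCommutativeRing seriesRing
  ℤ⟶series = record
    { ⟦_⟧ = constant
    ; +-homo = λ x y → ≡⇒≋ λ { zero → ≡.refl ; (suc _) → ≡.refl }
    ; *-homo = λ x y → coefficientwise λ n → ≈-sym (≈-trans (constant-⊛ x (constant y) n)
        (≈-reflexive (product x y n)))
    ; -‿homo = λ x → ≡⇒≋ λ { zero → ≡.refl ; (suc _) → ≡.refl }
    ; 0-homo = ≡⇒≋ λ _ → ≡.refl
    ; 1-homo = ≡⇒≋ λ _ → ≡.refl
    }
    where
    product : ∀ x y n → x * constant y n ≡ constant (x * y) n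
    product x y zero    = ≡.refl
    product x y (suc _) = ℤₚ.*-zeroʳ x

  module Ser = CommutativeRing seriesRing

-- Formal derivative, monomials and degree bounds

module Derivation (m : ℕ) where

  open Modular m

  ∂ : Series → Series
  ∂ f n = + suc n * f (suc n)

  ∂-cong : ∀ {f g} → f ≋ g → ∂ f ≋ ∂ g
  ∂-cong e = coefficientwise λ n → *-cong (≈-refl {+ suc n}) (at e (suc n))

  ∂-⊕ : ∀ f g → ∂ (f ⊕ g) ≋ ∂ f ⊕ ∂ g
  ∂-⊕ f g = coefficientwise λ n → ≈-reflexive (ℤₚ.*-distribˡ-+ (+ suc n) (f (suc n)) (g (suc n)))

  ∂-⊖ : ∀ f → ∂ (⊖ f) ≋ ⊖ ∂ f
  ∂-⊖ f = coefficientwise λ n → ≈-reflexive (≡.sym (ℤₚ.neg-distribʳ-* (+ suc n) (f (suc n))))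

  ∂-constant : ∀ x → ∂ (constant x) ≋ constant 0ℤ
  ∂-constant x = coefficientwise λ n →
    ≈-reflexive (≡.trans (ℤₚ.*-zeroʳ (+ suc n)) (≡.sym (constant-0 n)))

  private
    θ : Series → Series
    θ f n = + n * f n

    -- `θ` is the Euler operator X d/dX. Unlike `∂` it keeps indices in place, which lets the
    -- Leibniz rule be proved by induction on n; the rule for `∂` follows because `∂ f` is
    -- `θ f ∘ suc`.
    θ-⊛ : ∀ f g n → + n * (f ⊛ g) n ≈ (θ f ⊛ g) n + (f ⊛ θ g) n
    θ-⊛ f g zero    = ≈-reflexive (eq (f 0) (g 0))
      where
      eq : ∀ a b → 0ℤ * (a * b) ≡ 0ℤ * a * b + a * (0ℤ * b)
      eq = solve-∀
    θ-⊛ f g (suc n) = begin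
      + suc n * (f 0 * g (suc n) + W)
        ≈⟨ ≈-reflexive (eq₁ (+ n) (f 0) (g (suc n)) W) ⟩
      f 0 * (+ suc n * g (suc n)) + (W + + n * W)
        ≈⟨ +-cong (≈-refl {f 0 * (+ suc n * g (suc n))}) (+-cong (≈-refl {W}) (θ-⊛ (f ∘ suc) g n)) ⟩
      f 0 * (+ suc n * g (suc n)) + (W + ((θ (f ∘ suc) ⊛ g) n + (f ∘ suc ⊛ θ g) n))
        ≈⟨ ≈-reflexive (eq₂ (f 0) (f 0 * (+ suc n * g (suc n))) (g (suc n)) W
             ((θ (f ∘ suc) ⊛ g) n) ((f ∘ suc ⊛ θ g) n)) ⟩
      (0ℤ * f 0 * g (suc n) + (W + (θ (f ∘ suc) ⊛ g) n)) + (f 0 * (+ suc n * g (suc n)) + (f ∘ suc ⊛ θ g) n)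
        ≈⟨ +-cong (+-cong (≈-refl {0ℤ * f 0 * g (suc n)}) (≈-sym split)) ≈-refl ⟩
      (θ f ⊛ g) (suc n) + (f ⊛ θ g) (suc n) ∎
      where
      open SetoidReasoning setoid
      W : ℤ
      W = (f ∘ suc ⊛ g) n
      eq₁ : ∀ n a b w → (1ℤ + n) * (a * b + w) ≡ a * ((1ℤ + n) * b) + (w + n * w)
      eq₁ = solve-∀
      eq₂ : ∀ a b c w u v → b + (w + (u + v)) ≡ (0ℤ * a * c + (w + u)) + (b + v)
      eq₂ = solve-∀
      split : ((θ f ∘ suc) ⊛ g) n ≈ W + (θ (f ∘ suc) ⊛ g) n
      split = ≈-trans
        (at (⊛-cong {θ f ∘ suc} {(f ∘ suc) ⊕ θ (f ∘ suc)} {g}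
          (coefficientwise λ i → ≈-reflexive (eq₃ (+ i) (f (suc i)))) Ser.refl) n)
        (≈-reflexive (⊛-distribʳ g (f ∘ suc) (θ (f ∘ suc)) n))
        where
        eq₃ : ∀ i a → (1ℤ + i) * a ≡ a + i * a
        eq₃ = solve-∀

  ∂-⊛ : ∀ f g → ∂ (f ⊛ g) ≋ ∂ f ⊛ g ⊕ f ⊛ ∂ g
  ∂-⊛ f g = coefficientwise λ n → ≈-trans (θ-⊛ f g (suc n)) (≈-reflexive (≡.trans
    (≡.cong (λ z → (θ f ⊛ g) (suc n) + z) (⊛-suc f (θ g) n))
    (eq (f 0) (f (suc n)) (g 0) (g (suc n)) ((∂ f ⊛ g) n) ((f ⊛ ∂ g) n))))
    where
    eq : ∀ a a′ b b′ u v → (0ℤ * a * b′ + u) + (a′ * (0ℤ * b) + v) ≡ u + v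
    eq = solve-∀

  monomial : ℕ → Series
  monomial zero    = constant 1ℤ
  monomial (suc m) zero    = 0ℤ
  monomial (suc m) (suc i) = monomial m i

  monomial-same : ∀ m → monomial m m ≡ 1ℤ
  monomial-same zero    = ≡.refl
  monomial-same (suc m) = monomial-same m

  monomial-other : ∀ m i → i ≢ m → monomial m i ≡ 0ℤ
  monomial-other zero    zero    i≢m = contradiction ≡.refl i≢m
  monomial-other zero    (suc i) i≢m = ≡.refl
  monomial-other (suc m) zero    i≢m = ≡.refl
  monomial-other (suc m) (suc i) i≢m = monomial-other m i (i≢m ∘ ≡.cong suc)

  monomial-⊛ : ∀ m f i → (monomial m ⊛ f) (m ℕ.+ i) ≈ f i
  monomial-⊛ zero    f i = ≈-trans (constant-⊛ 1ℤ f i) (≈-reflexive (ℤₚ.*-identityˡ (f i)))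
  monomial-⊛ (suc m) f i = ≈-trans
    (≈-reflexive (ℤₚ.+-identityˡ ((monomial m ⊛ f) (m ℕ.+ i)))) (monomial-⊛ m f i)

  X : Series
  X = monomial 1

  ∂X≋1 : ∂ X ≋ constant 1ℤ
  ∂X≋1 = coefficientwise λ { zero → ≈-refl ; (suc n) → ≈-reflexive (ℤₚ.*-zeroʳ (+ suc (suc n))) }

  isDerivation : IsDerivation seriesRing ∂
  isDerivation = record
    { ∂-cong = ∂-cong
    ; ∂-+    = ∂-⊕
    ; ∂-neg  = ∂-⊖
    ; ∂-*    = ∂-⊛
    ; ∂-1    = ∂-constant 1ℤ
    }

  open DifferentialRing seriesRing ℤ⟶series ∂ isDerivation public

  X-Xᵐ : Series
  X-Xᵐ = X ⊕ ⊖ monomial m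

  Degree≤ : ℕ → Series → Set
  Degree≤ n f = ∀ i → n < i → f i ≈ 0ℤ

  degree-mono : ∀ {m n f} → m ≤ n → Degree≤ m f → Degree≤ n f
  degree-mono m≤n δ i n<i = δ i (ℕₚ.≤-<-trans m≤n n<i)

  degree-constant : ∀ x → Degree≤ 0 (constant x)
  degree-constant x (suc i) _ = ≈-refl

  degree-⊕ : ∀ {n f g} → Degree≤ n f → Degree≤ n g → Degree≤ n (f ⊕ g)
  degree-⊕ δ δ′ i n<i = ≈0-+ (δ i n<i) (δ′ i n<i)

  degree-⊖ : ∀ {n f} → Degree≤ n f → Degree≤ n (⊖ f)
  degree-⊖ δ i n<i = -‿cong (δ i n<i)

  degree-∂ : ∀ {n f} → Degree≤ (suc n) f → Degree≤ n (∂ f)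
  degree-∂ δ i n<i = ≈0-*ʳ (+ suc i) (δ (suc i) (s≤s n<i))

  top-coefficient : ∀ m n f g → Degree≤ m f → Degree≤ n g → (f ⊛ g) (m ℕ.+ n) ≈ f m * g n
  top-coefficient zero zero    f g δ δ′ = ≈-refl
  top-coefficient zero (suc n) f g δ δ′ = ≈-trans
    (+-cong (≈-refl {f 0 * g (suc n)}) (⊛-zeroˡ (f ∘ suc) g (λ i → δ (suc i) (s≤s z≤n)) n))
    (≈-reflexive (ℤₚ.+-identityʳ (f 0 * g (suc n))))
  top-coefficient (suc m) n f g δ δ′ = ≈-trans
    (+-cong (≈0-*ʳ (f 0) (δ′ (suc (m ℕ.+ n)) (s≤s (ℕₚ.m≤n+m n m))))
            (top-coefficient m n (f ∘ suc) g (λ i m<i → δ (suc i) (s≤s m<i)) δ′))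
    (≈-reflexive (ℤₚ.+-identityˡ (f (suc m) * g n)))

  -- Write i = m + (i - m) and weaken the bound on g to i - m, which exceeds n: the coefficient
  -- becomes a "top coefficient" `f m * g (i ∸ m)` whose second factor vanishes.
  degree-⊛ : ∀ {m n f g} → Degree≤ m f → Degree≤ n g → Degree≤ (m ℕ.+ n) (f ⊛ g)
  degree-⊛ {m} {n} {f} {g} δ δ′ i m+n<i = ≡.subst (λ j → (f ⊛ g) j ≈ 0ℤ) (ℕₚ.m+[n∸m]≡n m≤i)
    (≈-trans (top-coefficient m (i ℕ.∸ m) f g δ (degree-mono (ℕₚ.<⇒≤ n<i∸m) δ′))
             (≈0-*ʳ (f m) (δ′ (i ℕ.∸ m) n<i∸m)))
    where
    m≤i : m ≤ i
    m≤i = ℕₚ.≤-trans (ℕₚ.m≤m+n m n) (ℕₚ.<⇒≤ m+n<i)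
    n<i∸m : n < i ℕ.∸ m
    n<i∸m = ℕₚ.m+n≤o⇒m≤o∸n (suc n) (≡.subst (_≤ i) (≡.cong suc (ℕₚ.+-comm m n)) m+n<i)

-- Cancellation modulo a prime

module PrimeModulus (p : ℕ) (prime : Prime p) where

  open Modular p
  open Derivation p

  private
    abs-divides : ∀ {x} → x ≈ 0ℤ → p ℕᵈ.∣ ∣ x ∣
    abs-divides {x} e = ≡.subst (λ z → p ℕᵈ.∣ ∣ z ∣) (ℤₚ.+-identityʳ x) (∣⇒∣ᵤ (difference e))

    abs-divides⁻¹ : ∀ {x} → p ℕᵈ.∣ ∣ x ∣ → x ≈ 0ℤ
    abs-divides⁻¹ {x} d = congruent (∣ᵤ⇒∣ (≡.subst (λ z → p ℕᵈ.∣ ∣ z ∣) (≡.sym (ℤₚ.+-identityʳ x)) d))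

  no-zero-divisors : ∀ x y → x * y ≈ 0ℤ → x ≈ 0ℤ ⊎ y ≈ 0ℤ
  no-zero-divisors x y e = Sum.map abs-divides⁻¹ abs-divides⁻¹
    (euclidsLemma ∣ x ∣ ∣ y ∣ prime
      (≡.subst (p ℕᵈ.∣_) (ℤₚ.abs-* x y) (abs-divides e)))

  cancel-nonzero : ∀ x {y} → ¬ x ≈ 0ℤ → x * y ≈ 0ℤ → y ≈ 0ℤ
  cancel-nonzero x {y} x≉0 e = Sum.[ (λ x≈0 → contradiction x≈0 x≉0) , (λ y≈0 → y≈0) ] (no-zero-divisors x y e)

  small≉0 : ∀ i → suc i < p → ¬ + suc i ≈ 0ℤ
  small≉0 i i<p e = ℕₚ.<⇒≱ i<p (ℕᵈ.∣⇒≤ (abs-divides e))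

  -- Replaces division by H. While the degree bound u of U is at least e, the top coefficient of U
  -- times that of H is a coefficient of the product, hence 0, and the bound drops by one. The given
  -- u is only the start of this descent. With e = 1 the cofactor is constant, with e = 0 it is
  -- zero.
  cofactor-vanishes : ∀ h H e u U → Degree≤ h H → ¬ H h ≈ 0ℤ → Degree≤ u U →
    (∀ i → e ≤ i → (H ⊛ U) (h ℕ.+ i) ≈ 0ℤ) → ∀ i → e ≤ i → U i ≈ 0ℤ
  cofactor-vanishes h H e u U δH top δU product = go u δU
    where
    top-vanishes : ∀ u → Degree≤ u U → e ≤ u → U u ≈ 0ℤ
    top-vanishes u δU e≤u = cancel-nonzero (H h) top
      (≈-trans (≈-sym (top-coefficient h u H U δH δU)) (product u e≤u))

    go : ∀ u → Degree≤ u U → ∀ i → e ≤ i → U i ≈ 0ℤ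
    go zero    δU zero    e≤i = top-vanishes zero δU e≤i
    go zero    δU (suc i) e≤i = δU (suc i) (s≤s z≤n)
    go (suc u) δU i       e≤i with i ℕₚ.≤? suc u
    ... | no  i≰u = δU i (ℕₚ.≰⇒> i≰u)
    ... | yes i≤u = go u δU′ i e≤i
      where
      δU′ : Degree≤ u U
      δU′ j u<j with j ℕₚ.≟ suc u
      ... | yes ≡.refl = top-vanishes (suc u) δU (ℕₚ.≤-trans e≤i i≤u)
      ... | no  j≢     = δU j (ℕₚ.≤∧≢⇒< u<j (j≢ ∘ ≡.sym))

-- Finite sums and binomial coefficients

∑ : ℕ → (ℕ → ℤ) → ℤ
∑ zero    φ = 0ℤ
∑ (suc n) φ = ∑ n φ + φ n

∑-cong : ∀ n {φ ψ} → (∀ x → φ x ≡ ψ x) → ∑ n φ ≡ ∑ n ψ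
∑-cong zero    e = ≡.refl
∑-cong (suc n) e = ≡.cong₂ _+_ (∑-cong n e) (e n)

∑-linear : ∀ n a b φ ψ → ∑ n (λ x → a * φ x + b * ψ x) ≡ a * ∑ n φ + b * ∑ n ψ
∑-linear zero    a b φ ψ = ≡.sym (≡.cong₂ _+_ (ℤₚ.*-zeroʳ a) (ℤₚ.*-zeroʳ b))
∑-linear (suc n) a b φ ψ rewrite ∑-linear n a b φ ψ = eq a b (∑ n φ) (∑ n ψ) (φ n) (ψ n)
  where
  eq : ∀ a b s t u v → (a * s + b * t) + (a * u + b * v) ≡ a * (s + u) + b * (t + v)
  eq = solve-∀

nC0≡1 : ∀ n → n C 0 ≡ 1
nC0≡1 n = ≡.trans (nCk≡nC[n∸k] {0} {n} z≤n) (nCn≡1 n)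

-- Multiplication by n expressed in the binomial basis. It yields both the divisibility of binomial
-- coefficients by p and the reduction of power sums.
*-C : ∀ n k → n ℕ.* (n C k) ≡ suc k ℕ.* (n C suc k) ℕ.+ k ℕ.* (n C k)
*-C n zero rewrite nC0≡1 n | nC1≡n n | ℕₚ.*-identityʳ n = ≡.sym (≡.trans (ℕₚ.+-identityʳ _) (ℕₚ.*-identityˡ n))
*-C zero    (suc k)
  rewrite k>n⇒nCk≡0 {0} {suc k} (s≤s z≤n) | k>n⇒nCk≡0 {0} {suc (suc k)} (s≤s z≤n) | ℕₚ.*-zeroʳ k = ≡.refl
*-C (suc n) (suc k)
  rewrite ≡.sym (nCk+nC[k+1]≡[n+1]C[k+1] n k) | ≡.sym (nCk+nC[k+1]≡[n+1]C[k+1] n (suc k)) =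
  ≡.trans (eq₁ n (n C k) (n C suc k))
    (≡.trans (≡.cong₂ (λ u v → (n C k) ℕ.+ (n C suc k) ℕ.+ (u ℕ.+ v)) (*-C n k) (*-C n (suc k)))
             (eq₂ k (n C k) (n C suc k) (n C suc (suc k))))
  where
  eq₁ : ∀ n a b → suc n ℕ.* (a ℕ.+ b) ≡ a ℕ.+ b ℕ.+ (n ℕ.* a ℕ.+ n ℕ.* b)
  eq₁ = ℕ-solve-∀
  eq₂ : ∀ k a b c → a ℕ.+ b ℕ.+ ((suc k ℕ.* b ℕ.+ k ℕ.* a) ℕ.+ (suc (suc k) ℕ.* c ℕ.+ suc k ℕ.* b))
                  ≡ suc (suc k) ℕ.* (b ℕ.+ c) ℕ.+ suc k ℕ.* (a ℕ.+ b)
  eq₂ = ℕ-solve-∀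

hockey-stick : ∀ n k → ∑ n (λ x → + (x C k)) ≡ + (n C suc k)
hockey-stick zero    k = ≡.cong +_ (≡.sym (k>n⇒nCk≡0 {0} {suc k} (s≤s z≤n)))
hockey-stick (suc n) k rewrite hockey-stick n k =
  ≡.cong +_ (≡.trans (ℕₚ.+-comm (n C suc k) (n C k)) (nCk+nC[k+1]≡[n+1]C[k+1] n k))

-- Pascal's rule summed over a truncated range. Leaving the cut-off N independent of n permits
-- induction on N; at N = n + 1 the surplus term contains `n C suc n`, which is 0.
partialBinomial : ∀ n x N → ∑ (suc N) (λ k → + (suc n C k) * x ^ k) ≡
                  ∑ (suc N) (λ k → + (n C k) * x ^ k) + x * ∑ N (λ k → + (n C k) * x ^ k)
partialBinomial n x zero rewrite nC0≡1 n | nC0≡1 (suc n) | ℤₚ.*-zeroʳ x = ≡.refl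
partialBinomial n x (suc N)
  rewrite partialBinomial n x N | ≡.sym (nCk+nC[k+1]≡[n+1]C[k+1] n N) =
  eq x (∑ N (λ k → + (n C k) * x ^ k)) (+ (n C N)) (x ^ N) (+ (n C suc N))
  where
  eq : ∀ x s a y b → s + a * y + x * s + (a + b) * (x * y) ≡ s + a * y + b * (x * y) + x * (s + a * y)
  eq = solve-∀

binomial : ∀ n x → ∑ (suc n) (λ k → + (n C k) * x ^ k) ≡ (x + 1ℤ) ^ n
binomial zero    x = ≡.refl
binomial (suc n) x
  rewrite partialBinomial n x (suc n) | k>n⇒nCk≡0 (ℕₚ.n<1+n n) | binomial n x =
  eq x ((x + 1ℤ) ^ n) (x ^ suc n)
  where
  eq : ∀ x y z → y + 0ℤ * z + x * y ≡ (x + 1ℤ) * y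
  eq = solve-∀

-- Fermat's little theorem and power sums modulo p

module PowerSums (q : ℕ) (prime : Prime (suc q)) where

  private
    p : ℕ
    p = suc q

  open Modular p
  open PrimeModulus p prime

  ∑-≈0 : ∀ n {φ} → (∀ x → φ x ≈ 0ℤ) → ∑ n φ ≈ 0ℤ
  ∑-≈0 zero    e = ≈-refl
  ∑-≈0 (suc n) e = ≈0-+ (∑-≈0 n e) (e n)

  ∑-≈ : ∀ n {φ ψ} → (∀ x → φ x ≈ ψ x) → ∑ n φ ≈ ∑ n ψ
  ∑-≈ zero    e = ≈-refl
  ∑-≈ (suc n) e = +-cong (∑-≈ n e) (e n)

  -- By `*-C`, (k+1) C(p,k+1) = p C(p,k) - k C(p,k). The first term is a multiple of p and the
  -- second vanishes by induction; only at the end is k + 1 cancelled.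
  pCk≈0 : ∀ k → suc k < p → + (p C suc k) ≈ 0ℤ
  pCk≈0 k k<p = cancel-nonzero (+ suc k) (small≉0 k k<p) (step k k<p)
    where
    step : ∀ k → suc k < p → + suc k * + (p C suc k) ≈ 0ℤ
    step k k<p = begin
      + suc k * + (p C suc k)
        ≈⟨ ≈-reflexive (eq₁ (+ suc k * + (p C suc k)) (+ k * + (p C k))) ⟩
      + suc k * + (p C suc k) + + k * + (p C k) - + k * + (p C k)
        ≈⟨ ≈-reflexive (≡.cong (_- + k * + (p C k)) (≡.sym absorb)) ⟩
      + p * + (p C k) - + k * + (p C k)
        ≈⟨ +-cong (≈0-*ˡ (+ (p C k)) modulus≈0) (-‿cong (below k k<p)) ⟩
      0ℤ                                             ∎
      where
      open SetoidReasoning setoid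
      eq₁ : ∀ u v → u ≡ u + v - v
      eq₁ = solve-∀
      absorb : + p * + (p C k) ≡ + suc k * + (p C suc k) + + k * + (p C k)
      absorb = ≡.trans (≡.sym (ℤₚ.pos-* p (p C k))) (≡.trans (≡.cong +_ (*-C p k))
        (≡.cong₂ _+_ (ℤₚ.pos-* (suc k) (p C suc k)) (ℤₚ.pos-* k (p C k))))
      below : ∀ k → suc k < p → + k * + (p C k) ≈ 0ℤ
      below zero    _    = ≈-refl
      below (suc k) k<p  = step k (ℕₚ.<-trans (ℕₚ.n<1+n (suc k)) k<p)

  frobenius : ∀ x → (x + 1ℤ) ^ p ≈ x ^ p + 1ℤ
  frobenius x = begin
    (x + 1ℤ) ^ p                                       ≈⟨ ≈-reflexive (≡.sym (binomial p x)) ⟩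
    ∑ p (λ k → + (p C k) * x ^ k) + + (p C p) * x ^ p
      ≈⟨ +-cong (low q (ℕₚ.n<1+n q)) (≈-reflexive (≡.cong (λ z → + z * x ^ p) (nCn≡1 p))) ⟩
    1ℤ + 1ℤ * x ^ p                                    ≈⟨ ≈-reflexive (eq (x ^ p)) ⟩
    x ^ p + 1ℤ                                         ∎
    where
    open SetoidReasoning setoid
    eq : ∀ y → 1ℤ + 1ℤ * y ≡ y + 1ℤ
    eq = solve-∀
    low : ∀ n → n < p → ∑ (suc n) (λ k → + (p C k) * x ^ k) ≈ 1ℤ
    low zero    _   = ≈-reflexive (≡.cong (λ z → 0ℤ + + z * 1ℤ) (nC0≡1 p))
    low (suc n) n<p = +-cong (low n (ℕₚ.<-trans (ℕₚ.n<1+n n) n<p)) (≈0-*ˡ (x ^ suc n) (pCk≈0 n n<p))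

  fermat : ∀ x → (+ x) ^ p ≈ + x
  fermat zero    = ≈-refl
  fermat (suc x) = begin
    (+ suc x) ^ p      ≈⟨ ≈-reflexive (≡.cong (λ y → (+ y) ^ p) (ℕₚ.+-comm 1 x)) ⟩
    (+ x + 1ℤ) ^ p     ≈⟨ frobenius (+ x) ⟩
    (+ x) ^ p + 1ℤ     ≈⟨ +-cong (fermat x) (≈-refl {1ℤ}) ⟩
    + x + 1ℤ           ≈⟨ ≈-reflexive (≡.cong +_ (ℕₚ.+-comm x 1)) ⟩
    + suc x            ∎
    where open SetoidReasoning setoid

  fermat-unit : ∀ x → suc x < p → (+ suc x) ^ q ≈ 1ℤ
  fermat-unit x x<p = begin
    y ^ q             ≈⟨ ≈-reflexive (eq₁ (y ^ q)) ⟩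
    y ^ q - 1ℤ + 1ℤ   ≈⟨ +-cong (cancel-nonzero y (small≉0 x x<p) cancelled) (≈-refl {1ℤ}) ⟩
    1ℤ                ∎
    where
    open SetoidReasoning setoid
    y : ℤ
    y = + suc x
    eq₁ : ∀ z → z ≡ z - 1ℤ + 1ℤ
    eq₁ = solve-∀
    eq₂ : ∀ y z → y * (z - 1ℤ) ≡ y * z - y
    eq₂ = solve-∀
    cancelled : y * (y ^ q - 1ℤ) ≈ 0ℤ
    cancelled = ≈-trans (≈-reflexive (eq₂ y (y ^ q)))
      (≈-trans (+-cong (fermat (suc x)) (≈-refl { - y})) (≈-reflexive (ℤₚ.+-inverseʳ y)))

  -- The weight C(x,k) makes the induction on m possible: `*-C` absorbs one factor x at the price of
  -- raising k by at most one. For m = 0 the hockey-stick identity leaves C(p,k+1), a multiple of p.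
  binomial-power-sum : ∀ m k → suc (m ℕ.+ k) < p → ∑ p (λ x → + (x C k) * (+ x) ^ m) ≈ 0ℤ
  binomial-power-sum zero    k k<p = ≈-trans
    (≈-reflexive (≡.trans (∑-cong p (λ x → ℤₚ.*-identityʳ (+ (x C k)))) (hockey-stick p k)))
    (pCk≈0 k k<p)
  binomial-power-sum (suc m) k m+k<p = begin
    ∑ p (λ x → + (x C k) * (+ x) ^ suc m)
      ≈⟨ ≈-reflexive (∑-cong p absorb) ⟩
    ∑ p (λ x → + suc k * (+ (x C suc k) * (+ x) ^ m) + + k * (+ (x C k) * (+ x) ^ m))
      ≈⟨ ≈-reflexive (∑-linear p (+ suc k) (+ k) (λ x → + (x C suc k) * (+ x) ^ m) (λ x → + (x C k) * (+ x) ^ m)) ⟩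
    + suc k * ∑ p (λ x → + (x C suc k) * (+ x) ^ m) + + k * ∑ p (λ x → + (x C k) * (+ x) ^ m)
      ≈⟨ ≈0-+ (≈0-*ʳ (+ suc k) (binomial-power-sum m (suc k) (≡.subst (λ z → suc z < p) (≡.sym (ℕₚ.+-suc m k)) m+k<p)))
              (≈0-*ʳ (+ k) (binomial-power-sum m k (ℕₚ.<-trans (ℕₚ.n<1+n (suc (m ℕ.+ k))) m+k<p))) ⟩
    0ℤ ∎
    where
    open SetoidReasoning setoid
    eq₁ : ∀ c x y → c * (x * y) ≡ x * c * y
    eq₁ = solve-∀
    eq₂ : ∀ a b c d y → (a * b + c * d) * y ≡ a * (b * y) + c * (d * y)
    eq₂ = solve-∀
    absorb : ∀ x → + (x C k) * (+ x) ^ suc m ≡ + suc k * (+ (x C suc k) * (+ x) ^ m) + + k * (+ (x C k) * (+ x) ^ m)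
    absorb x = ≡.trans (eq₁ (+ (x C k)) (+ x) ((+ x) ^ m)) (≡.trans
      (≡.cong (_* (+ x) ^ m) (≡.trans (≡.sym (ℤₚ.pos-* x (x C k))) (≡.trans (≡.cong +_ (*-C x k))
        (≡.cong₂ _+_ (ℤₚ.pos-* (suc k) (x C suc k)) (ℤₚ.pos-* k (x C k))))))
      (eq₂ (+ suc k) (+ (x C suc k)) (+ k) (+ (x C k)) ((+ x) ^ m)))

  power-sum : ∀ m → suc m < p → ∑ p (λ x → (+ x) ^ m) ≈ 0ℤ
  power-sum m m<p = ≈-trans
    (≈-reflexive (∑-cong p λ x → ≡.sym (≡.trans (≡.cong (λ z → + z * (+ x) ^ m) (nC0≡1 x)) (ℤₚ.*-identityˡ ((+ x) ^ m)))))
    (binomial-power-sum m 0 (≡.subst (λ z → suc z < p) (≡.sym (ℕₚ.+-identityʳ m)) m<p))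

  -- The term x = 0 contributes 0, as q is positive, and each of the q units contributes 1; finally
  -- q = p - 1.
  power-sum-top : 0 < q → ∑ p (λ x → (+ x) ^ q) ≈ - 1ℤ
  power-sum-top 0<q = ≈-trans (up-to q (ℕₚ.n<1+n q))
    (≈-trans (≈-reflexive (eq (+ q))) (+-cong modulus≈0 (≈-refl { - 1ℤ})))
    where
    eq : ∀ q → q ≡ (1ℤ + q) - 1ℤ
    eq = solve-∀
    0^ : ∀ q → 0 < q → 0ℤ ^ q ≡ 0ℤ
    0^ (suc q) _ = ≡.refl
    up-to : ∀ n → n < p → ∑ (suc n) (λ x → (+ x) ^ q) ≈ + n
    up-to zero    _   = ≈-reflexive (≡.cong (λ z → 0ℤ + z) (0^ q 0<q))
    up-to (suc n) n<p = ≈-trans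
      (+-cong (up-to n (ℕₚ.<-trans (ℕₚ.n<1+n n) n<p)) (fermat-unit n n<p))
      (≈-reflexive (≡.cong +_ (ℕₚ.+-comm n 1)))

-- From the logarithmic derivative to the equation for the leading coefficient

module LogarithmicDerivative (e : ℕ) (prime : Prime (suc (suc e ℕ.+ suc e))) where

  d p : ℕ
  d = suc e
  p = suc (d ℕ.+ d)

  open Modular p
  open Derivation p
  open PrimeModulus p prime

  open Algebra.Properties.Ring Ser.ring using (-‿distribˡ-*)

  S : Series
  S = X-Xᵐ

  ∂S≋1 : ∂ S ≋ constant 1ℤ
  ∂S≋1 = Ser.trans (∂-⊕ X (⊖ monomial p)) (coefficientwise λ n →
    ≈-trans (+-cong (at ∂X≋1 n) (≈-trans (at (∂-⊖ (monomial p)) n) (-‿cong (vanish n))))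
            (≈-reflexive (ℤₚ.+-identityʳ (constant 1ℤ n))))
    where
    vanish : ∀ n → ∂ (monomial p) n ≈ 0ℤ
    vanish n with suc n ℕₚ.≟ p
    ... | yes ≡.refl = ≈0-*ˡ (monomial p p) modulus≈0
    ... | no  n≢p    = ≈0-*ʳ (+ suc n) (≈-reflexive (monomial-other p (suc n) n≢p))

  S-other : ∀ i → 2 ≤ i → i ≢ p → S i ≈ 0ℤ
  S-other i 2≤i i≢p = ≈-reflexive (≡.cong₂ (λ x y → x + - y)
    (monomial-other 1 i (λ { ≡.refl → contradiction 2≤i λ { (s≤s ()) } })) (monomial-other p i i≢p))

  S-p : S p ≈ - 1ℤ
  S-p = ≈-reflexive (≡.cong (λ z → 0ℤ + - z) (monomial-same p))

  S-⊛ : ∀ f i → (S ⊛ f) (p ℕ.+ i) ≈ f (d ℕ.+ d ℕ.+ i) - f i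
  S-⊛ f i = begin
    (S ⊛ f) (p ℕ.+ i)
      ≈⟨ ≈-reflexive (⊛-distribʳ f X (⊖ monomial p) (p ℕ.+ i)) ⟩
    (X ⊛ f) (p ℕ.+ i) + ((⊖ monomial p) ⊛ f) (p ℕ.+ i)
      ≈⟨ +-cong (≈-refl {(X ⊛ f) (p ℕ.+ i)}) (≈-sym (at (-‿distribˡ-* (monomial p) f) (p ℕ.+ i))) ⟩
    (X ⊛ f) (p ℕ.+ i) - (monomial p ⊛ f) (p ℕ.+ i)
      ≈⟨ +-cong (monomial-⊛ 1 f (d ℕ.+ d ℕ.+ i)) (-‿cong (monomial-⊛ p f i)) ⟩
    f (d ℕ.+ d ℕ.+ i) - f i ∎
    where open SetoidReasoning setoid

  2≤1+d : 2 ≤ suc d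
  2≤1+d = s≤s (s≤s z≤n)

  1+d<p : suc d < p
  1+d<p = s≤s (ℕₚ.m<m+n d (s≤s z≤n))

  module _ (F P : Series) (δF : Degree≤ p F) (monic : F p ≈ 1ℤ) (δP : Degree≤ d P)
           (log-derivative : S ⊛ ∂ F ≋ P ⊛ F) where

    a : ℤ
    a = P d

    private
      G H : Series
      G = ∂ F
      H = F ⊕ S

    -- At index p + i + 1 the summand X F′ contributes nothing, since its coefficient there comes
    -- from F above degree p. What is left of S F′ is -F′ shifted by p, so P F determines F′ above
    -- its constant term.
    G-high : ∀ i → G (suc i) ≈ - (P ⊛ F) (p ℕ.+ suc i)
    G-high i = begin
      G (suc i)
        ≈⟨ ≈-reflexive (eq (G (d ℕ.+ d ℕ.+ suc i)) (G (suc i))) ⟩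
      G (d ℕ.+ d ℕ.+ suc i) - (G (d ℕ.+ d ℕ.+ suc i) - G (suc i))
        ≈⟨ +-cong vanish (-‿cong (≈-sym (S-⊛ G (suc i)))) ⟩
      0ℤ - (S ⊛ G) (p ℕ.+ suc i)
        ≈⟨ +-cong (≈-refl {0ℤ}) (-‿cong (at log-derivative (p ℕ.+ suc i))) ⟩
      0ℤ - (P ⊛ F) (p ℕ.+ suc i)
        ≈⟨ ≈-reflexive (ℤₚ.+-identityˡ (- (P ⊛ F) (p ℕ.+ suc i))) ⟩
      - (P ⊛ F) (p ℕ.+ suc i)                                ∎
      where
      open SetoidReasoning setoid
      eq : ∀ x y → y ≡ x - (x - y)
      eq = solve-∀
      vanish : G (d ℕ.+ d ℕ.+ suc i) ≈ 0ℤ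
      vanish = ≈0-*ʳ (+ suc (d ℕ.+ d ℕ.+ suc i)) (δF (p ℕ.+ suc i) (ℕₚ.m<m+n p (s≤s z≤n)))

    G-top : G d ≈ - a
    G-top = ≈-trans (G-high e) (-‿cong (begin
      (P ⊛ F) (p ℕ.+ d) ≈⟨ ≈-reflexive (≡.cong (P ⊛ F) (ℕₚ.+-comm p d)) ⟩
      (P ⊛ F) (d ℕ.+ p) ≈⟨ top-coefficient d p P F δP δF ⟩
      a * F p           ≈⟨ *-cong (≈-refl {a}) monic ⟩
      a * 1ℤ            ≈⟨ ≈-reflexive (ℤₚ.*-identityʳ a) ⟩
      a                 ∎))
      where open SetoidReasoning setoid

    δG : Degree≤ d G
    δG (suc i) d<i = ≈-trans (G-high i)
      (-‿cong (degree-⊛ {d} {p} {P} {F} δP δF (p ℕ.+ suc i)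
        (≡.subst (_< p ℕ.+ suc i) (ℕₚ.+-comm p d) (ℕₚ.+-monoʳ-< p d<i))))

    -- Between d + 1 and p the coefficient of F is one of F′ divided by a unit; at p the leading 1
    -- of F cancels the -1 of X - Xᵖ.
    δH : Degree≤ (suc d) H
    δH (suc i) (s≤s d<i) with ℕₚ.<-cmp (suc i) p
    ... | tri< i<p i≢p _ = ≈0-+ (cancel-nonzero (+ suc i) (small≉0 i i<p) (δG i d<i))
                                (S-other (suc i) (ℕₚ.≤-trans 2≤1+d (ℕₚ.<⇒≤ (s≤s d<i))) i≢p)
    ... | tri≈ _ ≡.refl _ = +-cong monic S-p
    ... | tri> _ i≢p p<i = ≈0-+ (δF (suc i) p<i) (S-other (suc i) (ℕₚ.≤-trans 2≤1+d (ℕₚ.<⇒≤ (s≤s d<i))) i≢p)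

    H-top : + suc d * H (suc d) ≈ - a
    H-top = begin
      + suc d * (F (suc d) + S (suc d))
        ≈⟨ *-cong (≈-refl {+ suc d}) (+-cong (≈-refl {F (suc d)}) (S-other (suc d) 2≤1+d (ℕₚ.<⇒≢ 1+d<p))) ⟩
      + suc d * (F (suc d) + 0ℤ) ≈⟨ ≈-reflexive (≡.cong (+ suc d *_) (ℤₚ.+-identityʳ (F (suc d)))) ⟩
      G d                        ≈⟨ G-top ⟩
      - a                        ∎
      where open SetoidReasoning setoid

    H⊛G : H ⊛ G ≋ F ⊛ (G ⊕ P)
    H⊛G = shifted-derivative S F P log-derivative

    k : ℤ
    k = (G ⊕ P) 0

    c : Series
    c = constant k

    1≉0 : ¬ 1ℤ ≈ 0ℤ
    1≉0 = small≉0 0 (s≤s (s≤s z≤n))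

    -- H F′ has degree at most (d+1) + d = p, already the degree of the factor F in F (F′ + P), so
    -- nothing is left for the cofactor above degree 0.
    G⊕P≋c : G ⊕ P ≋ c
    G⊕P≋c = coefficientwise λ
      { zero    → ≈-refl
      ; (suc i) → cofactor-vanishes p F 1 d (G ⊕ P) δF (λ F≈0 → 1≉0 (≈-trans (≈-sym monic) F≈0))
                    (degree-⊕ δG δP)
                    (λ j 1≤j → ≈-trans (≈-sym (at H⊛G (p ℕ.+ j)))
                      (degree-⊛ {suc d} {d} {H} {G} δH δG (p ℕ.+ j) (ℕₚ.m<m+n p 1≤j)))
                    (suc i) (s≤s z≤n)
      }

    k≈H*G : k ≈ H (suc d) * G d
    k≈H*G = begin
      k                         ≈⟨ ≈-reflexive (≡.sym (ℤₚ.*-identityˡ k)) ⟩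
      1ℤ * k                    ≈⟨ *-cong (≈-sym monic) (≈-refl {k}) ⟩
      F p * k                   ≈⟨ ≈-sym (top-coefficient p 0 F (G ⊕ P) δF δ0) ⟩
      (F ⊛ (G ⊕ P)) (p ℕ.+ 0)   ≈⟨ ≈-sym (at H⊛G (p ℕ.+ 0)) ⟩
      (H ⊛ G) (p ℕ.+ 0)         ≈⟨ ≈-reflexive (≡.cong (H ⊛ G) (ℕₚ.+-identityʳ p)) ⟩
      (H ⊛ G) (suc d ℕ.+ d)     ≈⟨ top-coefficient (suc d) d H G δH δG ⟩
      H (suc d) * G d           ∎
      where
      open SetoidReasoning setoid
      δ0 : Degree≤ 0 (G ⊕ P)
      δ0 (suc i) _ = at G⊕P≋c (suc i)

    -- The top coefficient of H is known only after multiplication by d + 1. Since 2(d+1) = p + 1, k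
    -- may be replaced by 2(d+1) k, which supplies that factor.
    k≈2a² : k ≈ + 2 * (a * a)
    k≈2a² = begin
      k                                         ≈⟨ ≈-reflexive (≡.sym (ℤₚ.+-identityˡ k)) ⟩
      0ℤ + k                                    ≈⟨ +-cong (≈-sym (≈0-*ˡ k modulus≈0)) (≈-refl {k}) ⟩
      + p * k + k                               ≈⟨ ≈-reflexive (eq₁ (+ d) k) ⟩
      + 2 * (+ suc d * k)
        ≈⟨ *-cong (≈-refl {+ 2}) (*-cong (≈-refl {+ suc d}) k≈H*G) ⟩
      + 2 * (+ suc d * (H (suc d) * G d))
        ≈⟨ ≈-reflexive (≡.cong (+ 2 *_) (≡.sym (ℤₚ.*-assoc (+ suc d) (H (suc d)) (G d)))) ⟩
      + 2 * (+ suc d * H (suc d) * G d)         ≈⟨ *-cong (≈-refl {+ 2}) (*-cong H-top G-top) ⟩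
      + 2 * (- a * - a)                         ≈⟨ ≈-reflexive (eq₂ a) ⟩
      + 2 * (a * a)                             ∎
      where
      open SetoidReasoning setoid
      eq₁ : ∀ d k → (1ℤ + (d + d)) * k + k ≡ + 2 * ((1ℤ + d) * k)
      eq₁ = solve-∀
      eq₂ : ∀ a → + 2 * (- a * - a) ≡ + 2 * (a * a)
      eq₂ = solve-∀

    -- The multiplier, the cofactor of H and the resultant in `elimination`, with c a constant
    -- series; hence R has degree 0.
    L V R : Series
    L = constant (+ 3) ⊛ P ⊕ ⊖ (c ⊕ constant 1ℤ)
    V = ∂ (∂ P) ⊛ L ⊕ ⊖ (constant (+ 9) ⊛ (∂ P ⊛ ∂ P))
    R = (constant (+ 2) ⊛ c ⊕ ⊖ constant 1ℤ) ⊛ (c ⊕ ⊖ constant (+ 2))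

    H⊛V : H ⊛ V ≋ R ⊛ ∂ P
    H⊛V = elimination S F P log-derivative c ∂S≋1 (∂-constant k) G⊕P≋c

    δR : Degree≤ 0 R
    δR = degree-⊛ {0} {0}
      (degree-⊕ (degree-⊛ {0} {0} (degree-constant (+ 2)) (degree-constant k)) (degree-⊖ (degree-constant 1ℤ)))
      (degree-⊕ (degree-constant k) (degree-⊖ (degree-constant (+ 2))))

    δ∂P : Degree≤ e (∂ P)
    δ∂P = degree-∂ δP

    δV : Degree≤ (e ℕ.+ d) V
    δV = degree-⊕
      (degree-⊛ {e} {d} {∂ (∂ P)} {L} (degree-∂ (degree-mono (ℕₚ.n≤1+n e) δ∂P))
        (degree-⊕ (degree-⊛ {0} {d} (degree-constant (+ 3)) δP)
                  (degree-⊖ (degree-mono {0} z≤n (degree-⊕ (degree-constant k) (degree-constant 1ℤ))))))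
      (degree-⊖ (degree-⊛ {0} {e ℕ.+ d} (degree-constant (+ 9))
        (degree-⊛ {e} {d} δ∂P (degree-mono (ℕₚ.n≤1+n e) δ∂P))))

    module _ (a≉0 : ¬ a ≈ 0ℤ) where

      -- H has degree exactly d + 1 because a is nonzero, whereas H V = R P′ has degree at most d -
      -- 1.
      V≈0 : ∀ i → V i ≈ 0ℤ
      V≈0 i = cofactor-vanishes (suc d) H 0 (e ℕ.+ d) V δH H≉0 δV
        (λ j _ → ≈-trans (at H⊛V (suc d ℕ.+ j))
          (degree-⊛ {0} {e} {R} {∂ P} δR δ∂P (suc d ℕ.+ j)
            (ℕₚ.<-≤-trans (ℕₚ.n<1+n e) (ℕₚ.≤-trans (ℕₚ.n≤1+n d) (ℕₚ.m≤m+n (suc d) j)))))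
        i z≤n
        where
        H≉0 : ¬ H (suc d) ≈ 0ℤ
        H≉0 H≈0 = a≉0 (≈-trans (≈-reflexive (≡.sym (ℤₚ.neg-involutive a)))
          (-‿cong (≈-trans (≈-sym H-top) (≈0-*ʳ (+ suc d) H≈0))))

      R*∂P≈0 : R 0 * ∂ P e ≈ 0ℤ
      R*∂P≈0 = begin
        R 0 * ∂ P e    ≈⟨ ≈-sym (top-coefficient 0 e R (∂ P) δR δ∂P) ⟩
        (R ⊛ ∂ P) e    ≈⟨ ≈-sym (at H⊛V e) ⟩
        (H ⊛ V) e      ≈⟨ ≈-reflexive (⊛-comm H V e) ⟩
        (V ⊛ H) e      ≈⟨ ⊛-zeroˡ V H V≈0 e ⟩
        0ℤ             ∎
        where open SetoidReasoning setoid

      ∂P≉0 : ¬ ∂ P e ≈ 0ℤ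
      ∂P≉0 da≈0 = a≉0 (cancel-nonzero (+ d) (small≉0 e (ℕₚ.<-trans (ℕₚ.n<1+n d) 1+d<p)) da≈0)

      R≈0 : R 0 ≈ 0ℤ
      R≈0 = Sum.fromInj₁ (λ ∂P≈0 → contradiction ∂P≈0 ∂P≉0) (no-zero-divisors (R 0) (∂ P e) R*∂P≈0)

      leading-coefficient-equation :
        (+ 2 * (+ 2 * (a * a)) - 1ℤ) * (+ 2 * (a * a) - + 2) ≈ 0ℤ
      leading-coefficient-equation = ≈-trans (resultant-cong (≈-sym k≈2a²)) R≈0
        where
        resultant-cong : ∀ {x y} → x ≈ y → (+ 2 * x - 1ℤ) * (x - + 2) ≈ (+ 2 * y - 1ℤ) * (y - + 2)
        resultant-cong {x} {y} x≈y =
          *-cong (+-cong (*-cong (≈-refl {+ 2}) x≈y) (≈-refl { - 1ℤ})) (+-cong x≈y (≈-refl { - + 2}))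

-- Horner evaluation and lists with multiplicities

horner : ∀ {m} → (Fin m → ℕ) → ℕ → ℕ
horner {zero}  f x = 0
horner {suc m} f x = f zero ℕ.+ horner (f ∘ suc) x ℕ.* x

-- The local function of evalℕ cannot be named here.  The with-abstractions make its arguments
-- distinct variables, so that unification can insert it for the omitted left-hand side.
mutual
  go*x≡horner*x : ∀ d (c : Fin (suc d) → ℕ) x m (f : Fin m → ℕ) → _ ≡ horner f x ℕ.* x

  evalℕ≡horner : ∀ {d} (c : Fin (suc d) → ℕ) x → evalℕ c x ≡ horner c x
  evalℕ≡horner {zero}  c x = ≡.refl
  evalℕ≡horner {suc d} c x with (λ (i : Fin d) → c (suc (suc i)))
  ... | f with c zero | c (suc zero)
  ... | a | b with suc d | c
  ... | e | c′ = ≡.cong (λ z → a ℕ.+ (b ℕ.+ z) ℕ.* x) (go*x≡horner*x e c′ x d f)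

  go*x≡horner*x d c x zero    f = ≡.refl
  go*x≡horner*x d c x (suc m) f = ≡.cong (λ z → (f zero ℕ.+ z) ℕ.* x) (go*x≡horner*x d c x m (f ∘ suc))

total : ∀ {A : Set} → (A → ℤ) → List A → ℤ
total φ []       = 0ℤ
total φ (x ∷ xs) = φ x + total φ xs

-- Encodes the exponents n(x) by repetition: F becomes a product of linear factors over the list,
-- and its degree is the length, that is, the sum of the values.
multiset : (ℕ → ℕ) → ℕ → List ℕ
multiset n zero    = []
multiset n (suc N) = replicate (n N) N ++ multiset n N

length-multiset : ∀ n N → length (multiset n N) ≡ sum (map n (upTo N))
length-multiset n zero    = ≡.refl
length-multiset n (suc N) = begin
  length (replicate (n N) N ++ multiset n N)       ≡⟨ length-++ (replicate (n N) N) ⟩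
  length (replicate (n N) N) ℕ.+ length (multiset n N)
    ≡⟨ ≡.cong₂ ℕ._+_ (length-replicate (n N)) (length-multiset n N) ⟩
  n N ℕ.+ sum (map n (upTo N))                     ≡⟨ ℕₚ.+-comm (n N) (sum (map n (upTo N))) ⟩
  sum (map n (upTo N)) ℕ.+ n N
    ≡⟨ ≡.cong (sum (map n (upTo N)) ℕ.+_) (ℕₚ.+-identityʳ (n N)) ⟨
  sum (map n (upTo N)) ℕ.+ sum (map n (N ∷ []))    ≡⟨ sum-++ (map n (upTo N)) (map n (N ∷ [])) ⟨
  sum (map n (upTo N) ++ map n (N ∷ []))           ≡⟨ ≡.cong sum (map-++ n (upTo N) (N ∷ [])) ⟨
  sum (map n (upTo N ∷ʳ N))                        ≡⟨ ≡.cong (λ xs → sum (map n xs)) (upTo-∷ʳ N) ⟩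
  sum (map n (upTo (suc N)))                       ∎
  where open ≡.≡-Reasoning

total-++-replicate : ∀ φ k (x : ℕ) xs → total φ (replicate k x ++ xs) ≡ + k * φ x + total φ xs
total-++-replicate φ zero    x xs = ≡.sym (ℤₚ.+-identityˡ (total φ xs))
total-++-replicate φ (suc k) x xs rewrite total-++-replicate φ k x xs = eq (+ k) (φ x) (total φ xs)
  where
  eq : ∀ k y t → y + (k * y + t) ≡ (1ℤ + k) * y + t
  eq = solve-∀

total-multiset : ∀ φ n N → total φ (multiset n N) ≡ ∑ N (λ x → + n x * φ x)
total-multiset φ n zero    = ≡.refl
total-multiset φ n (suc N)
  rewrite total-++-replicate φ (n N) N (multiset n N) | total-multiset φ n N =
  ℤₚ.+-comm (+ n N * φ N) (∑ N (λ x → + n x * φ x))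

-- Products of linear factors, Lagrange interpolation and moments

module SplitPolynomial (q : ℕ) (0<q : 0 < q) (prime : Prime (suc q)) where

  private
    p : ℕ
    p = suc q

  open Modular p
  open Derivation p
  open PrimeModulus p prime
  open PowerSums q prime

  linear : ℕ → Series
  linear r = X ⊕ ⊖ constant (+ r)

  ∂linear : ∀ r → ∂ (linear r) ≋ constant 1ℤ
  ∂linear r = coefficientwise λ
    { zero    → ≈-refl
    ; (suc n) → ≈-reflexive (ℤₚ.*-zeroʳ (+ suc (suc n)))
    }

  linear-⊛-suc : ∀ r f n → (linear r ⊛ f) (suc n) ≈ f n - + r * f (suc n)
  linear-⊛-suc r f n = begin
    (0ℤ - + r) * f (suc n) + ((linear r ∘ suc) ⊛ f) n
      ≈⟨ +-cong (≈-reflexive (eq (+ r) (f (suc n)))) (at (⊛-cong {linear r ∘ suc} {constant 1ℤ} {f} shift Ser.refl) n) ⟩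
    - (+ r * f (suc n)) + (constant 1ℤ ⊛ f) n
      ≈⟨ +-cong (≈-refl { - (+ r * f (suc n))}) (monomial-⊛ 0 f n) ⟩
    - (+ r * f (suc n)) + f n
      ≈⟨ ≈-reflexive (ℤₚ.+-comm (- (+ r * f (suc n))) (f n)) ⟩
    f n - + r * f (suc n) ∎
    where
    open SetoidReasoning setoid
    eq : ∀ r y → (0ℤ - r) * y ≡ - (r * y)
    eq = solve-∀
    shift : (linear r ∘ suc) ≋ constant 1ℤ
    shift = coefficientwise λ n → ≈-reflexive (ℤₚ.+-identityʳ (constant 1ℤ n))

  -- The quotient of Xᵐ − rᵐ by X − r.
  geometric : ℕ → ℕ → Series
  geometric zero    r i       = 0ℤ
  geometric (suc m) r zero    = (+ r) ^ m
  geometric (suc m) r (suc i) = geometric m r i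

  geometric-recurrence : ∀ m r n → geometric m r n - + r * geometric m r (suc n) ≡ monomial m (suc n)
  geometric-recurrence zero          r n       = ≡.cong (λ z → 0ℤ - z) (ℤₚ.*-zeroʳ (+ r))
  geometric-recurrence (suc zero)    r zero    = ≡.cong (λ z → 1ℤ - z) (ℤₚ.*-zeroʳ (+ r))
  geometric-recurrence (suc (suc m)) r zero    = ℤₚ.+-inverseʳ ((+ r) ^ suc m)
  geometric-recurrence (suc m)       r (suc n) = geometric-recurrence m r n

  geometric-high : ∀ m r i → m ≤ i → geometric m r i ≡ 0ℤ
  geometric-high zero    r i       _         = ≡.refl
  geometric-high (suc m) r (suc i) (s≤s m≤i) = geometric-high m r i m≤i

  geometric-coefficient : ∀ r i e → geometric (suc (i ℕ.+ e)) r i ≡ (+ r) ^ e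
  geometric-coefficient r zero    e = ≡.refl
  geometric-coefficient r (suc i) e = geometric-coefficient r i e

  -- The quotient of X − Xᵖ by X − r; it is the Lagrange polynomial which is 1 at r and 0 at all
  -- other residues.
  lagrange : ℕ → Series
  lagrange r = constant 1ℤ ⊕ ⊖ geometric p r

  -- The product is (X - r) - (Xᵖ - rᵖ), which differs from X - Xᵖ by the constant rᵖ - r; this is
  -- where Fermat's theorem enters.
  linear-⊛-lagrange : ∀ r → linear r ⊛ lagrange r ≋ X-Xᵐ
  linear-⊛-lagrange r = coefficientwise λ
    { zero    → ≈-trans (≈-reflexive (eq₀ (+ r) ((+ r) ^ q)))
                  (≈-trans (+-cong (fermat r) (≈-refl { - (+ r)})) (≈-reflexive (ℤₚ.+-inverseʳ (+ r))))
    ; (suc n) → ≈-trans (linear-⊛-suc r (lagrange r) n) (≈-reflexive (≡.trans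
        (eq₁ (+ r) (constant 1ℤ n) (geometric p r n) (geometric p r (suc n)))
        (≡.cong (λ z → constant 1ℤ n - z) (geometric-recurrence p r n))))
    }
    where
    eq₀ : ∀ r y → (0ℤ - r) * (1ℤ - y) ≡ r * y - r
    eq₀ = solve-∀
    eq₁ : ∀ r c g h → (c - g) - r * (0ℤ - h) ≡ c - (g - r * h)
    eq₁ = solve-∀

  fromRoots : List ℕ → Series
  fromRoots []       = constant 1ℤ
  fromRoots (r ∷ rs) = linear r ⊛ fromRoots rs

  indicator : List ℕ → Series
  indicator []       = constant 0ℤ
  indicator (r ∷ rs) = lagrange r ⊕ indicator rs

  degree-fromRoots : ∀ rs → Degree≤ (length rs) (fromRoots rs)
  degree-fromRoots []       = degree-constant 1ℤ
  degree-fromRoots (r ∷ rs) = degree-⊛ {1} {length rs} {linear r} {fromRoots rs} δ (degree-fromRoots rs)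
    where
    δ : Degree≤ 1 (linear r)
    δ (suc (suc i)) _ = ≈-refl
    δ (suc zero) (s≤s ())

  fromRoots-monic : ∀ rs → fromRoots rs (length rs) ≈ 1ℤ
  fromRoots-monic []       = ≈-refl
  fromRoots-monic (r ∷ rs) = ≈-trans (linear-⊛-suc r (fromRoots rs) (length rs))
    (+-cong (fromRoots-monic rs) (-‿cong (≈0-*ʳ (+ r) (degree-fromRoots rs (suc (length rs)) (ℕₚ.n<1+n (length rs))))))

  log-derivative : ∀ rs → X-Xᵐ ⊛ ∂ (fromRoots rs) ≋ indicator rs ⊛ fromRoots rs
  log-derivative []       = Ser.trans (Ser.*-cong {X-Xᵐ} Ser.refl (∂-constant 1ℤ))
    (Ser.trans (Ser.zeroʳ X-Xᵐ) (Ser.sym (Ser.zeroˡ (constant 1ℤ))))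
  log-derivative (r ∷ rs) = product-log-derivative X-Xᵐ (linear r) (lagrange r) (fromRoots rs) (indicator rs)
    (linear-⊛-lagrange r) (∂linear r) (log-derivative rs)

  indicator-high : ∀ rs i → p ≤ i → indicator rs i ≈ 0ℤ
  indicator-high []       (suc i) p≤i = ≈-refl
  indicator-high (r ∷ rs) (suc i) p≤i =
    ≈0-+ (≈-reflexive (≡.cong (λ z → 0ℤ - z) (geometric-high p r (suc i) p≤i))) (indicator-high rs (suc i) p≤i)

  -- Each `geometric p r` has the coefficient r^(q-j) at X^j. The index is kept positive because the
  -- 1 in `lagrange` affects the constant term.
  indicator-coefficient : ∀ rs i e → suc i ℕ.+ e ≡ q → indicator rs (suc i) ≡ - total (λ r → (+ r) ^ e) rs
  indicator-coefficient []       i e i+e = ≡.refl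
  indicator-coefficient (r ∷ rs) i e i+e = ≡.trans
    (≡.cong₂ (λ u v → (0ℤ - u) + v)
      (≡.subst (λ z → geometric (suc z) r (suc i) ≡ (+ r) ^ e) i+e (geometric-coefficient r (suc i) e))
      (indicator-coefficient rs i e i+e))
    (eq ((+ r) ^ e) (total (λ r → (+ r) ^ e) rs))
    where
    eq : ∀ x t → (0ℤ - x) + - t ≡ - (x + t)
    eq = solve-∀

  moment : ∀ {m} → (Fin m → ℕ) → ℕ → ℤ
  moment f e = ∑ p (λ x → + horner f x * (+ x) ^ e)

  -- One Horner step: removing the lowest coefficient moves a factor x into the weight, so m + e is
  -- preserved and can be compared with q.
  moment-step : ∀ {m} (f : Fin (suc m) → ℕ) e →
    moment f e ≡ + f zero * ∑ p (λ x → (+ x) ^ e) + 1ℤ * moment (f ∘ suc) (suc e)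
  moment-step f e = ≡.trans (∑-cong p expand)
    (∑-linear p (+ f zero) 1ℤ (λ x → (+ x) ^ e) (λ x → + horner (f ∘ suc) x * (+ x) ^ suc e))
    where
    eq : ∀ a h x y → (a + h * x) * y ≡ a * y + 1ℤ * (h * (x * y))
    eq = solve-∀
    expand : ∀ x → + horner f x * (+ x) ^ e ≡ + f zero * (+ x) ^ e + 1ℤ * (+ horner (f ∘ suc) x * (+ x) ^ suc e)
    expand x = ≡.trans
      (≡.cong (λ z → (+ f zero + z) * (+ x) ^ e) (ℤₚ.pos-* (horner (f ∘ suc) x) x))
      (eq (+ f zero) (+ horner (f ∘ suc) x) (+ x) ((+ x) ^ e))

  -- All powers that occur have exponent at most m - 1 + e, which is below q, so each power sum
  -- vanishes.
  moment-low : ∀ m (f : Fin m → ℕ) e → m ℕ.+ e ≤ q → moment f e ≈ 0ℤ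
  moment-low zero    f e _   = ∑-≈0 p (λ x → ≈-refl)
  moment-low (suc m) f e m+e<q = ≈-trans (≈-reflexive (moment-step f e))
    (≈0-+ (≈0-*ʳ (+ f zero) (power-sum e (s≤s (ℕₚ.≤-trans (s≤s (ℕₚ.m≤n+m e m)) m+e<q))))
          (≈0-*ʳ 1ℤ (moment-low m (f ∘ suc) (suc e) (≡.subst (_≤ q) (≡.sym (ℕₚ.+-suc m e)) m+e<q))))

  -- Only the top coefficient meets exponent q, where the power sum is -1 instead of 0.
  moment-top : ∀ m (f : Fin (suc m) → ℕ) e → m ℕ.+ e ≡ q → moment f e ≈ - + f (fromℕ m)
  moment-top zero f e ≡.refl = begin
    moment f e ≈⟨ ≈-reflexive (moment-step f e) ⟩
    + f zero * ∑ p (λ x → (+ x) ^ e) + 1ℤ * moment (f ∘ suc) (suc e)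
      ≈⟨ +-cong (*-cong (≈-refl {+ f zero}) (power-sum-top 0<q)) (≈0-*ʳ 1ℤ (∑-≈0 p (λ x → ≈-refl))) ⟩
    + f zero * - 1ℤ + 0ℤ ≈⟨ ≈-reflexive (eq (+ f zero)) ⟩
    - + f zero ∎
    where
    open SetoidReasoning setoid
    eq : ∀ a → a * - 1ℤ + 0ℤ ≡ - a
    eq = solve-∀
  moment-top (suc m) f e m+e = begin
    moment f e ≈⟨ ≈-reflexive (moment-step f e) ⟩
    + f zero * ∑ p (λ x → (+ x) ^ e) + 1ℤ * moment (f ∘ suc) (suc e)
      ≈⟨ +-cong (≈0-*ʳ (+ f zero) (power-sum e (s≤s (≡.subst (suc e ≤_) m+e (s≤s (ℕₚ.m≤n+m e m))))))
                (*-cong (≈-refl {1ℤ}) (moment-top m (f ∘ suc) (suc e) (≡.trans (ℕₚ.+-suc m e) m+e))) ⟩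
    0ℤ + 1ℤ * - + f (suc (fromℕ m)) ≈⟨ ≈-reflexive (eq (+ f (suc (fromℕ m)))) ⟩
    - + f (suc (fromℕ m)) ∎
    where
    open SetoidReasoning setoid
    eq : ∀ a → 0ℤ + 1ℤ * - a ≡ - a
    eq = solve-∀

-- The given polynomial and its possible leading coefficients

module LeadingCoefficient (e : ℕ) (prime : Prime (suc (suc e ℕ.+ suc e)))
  (c : Fin (suc (suc e)) → ℕ) (c<p : ∀ i → c i < suc (suc e ℕ.+ suc e)) (c≢0 : c (fromℕ (suc e)) ≢ 0)
  (value-sum : valueSum (suc (suc e ℕ.+ suc e)) c ≡ suc (suc e ℕ.+ suc e)) where

  private
    d q p a : ℕ
    d = suc e
    q = d ℕ.+ d
    p = suc q
    a = c (fromℕ d)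

  open Modular p
  open Derivation p
  open PrimeModulus p prime
  open PowerSums q prime
  open SplitPolynomial q (s≤s z≤n) prime
  open LogarithmicDerivative e prime using (leading-coefficient-equation)

  values : ℕ → ℕ
  values = evalMod p c

  roots : List ℕ
  roots = multiset values p

  F P : Series
  F = fromRoots roots
  P = indicator roots

  length-roots : length roots ≡ p
  length-roots = ≡.trans (length-multiset values p) value-sum

  δF : Degree≤ p F
  δF = ≡.subst (λ n → Degree≤ n F) length-roots (degree-fromRoots roots)

  F-monic : F p ≈ 1ℤ
  F-monic = ≡.subst (λ n → F n ≈ 1ℤ) length-roots (fromRoots-monic roots)

  values≈horner : ∀ x → + values x ≈ + horner c x
  values≈horner x = ≈-sym (congruent (divides (+ (v / p)) (begin
    + horner c x - + (v % p)
      ≡⟨ ≡.cong (λ z → + z - + (v % p)) (≡.trans (≡.sym (evalℕ≡horner c x)) (m≡m%n+[m/n]*n v p)) ⟩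
    + (v % p) + + (v / p ℕ.* p) - + (v % p) ≡⟨ eq (+ (v % p)) (+ (v / p ℕ.* p)) ⟩
    + (v / p ℕ.* p)                         ≡⟨ ℤₚ.pos-* (v / p) p ⟩
    + (v / p) * + p                         ∎)))
    where
    open ≡.≡-Reasoning
    v : ℕ
    v = evalℕ c x
    eq : ∀ r s → r + s - r ≡ s
    eq = solve-∀

  P≈moment : ∀ i k → suc i ℕ.+ k ≡ q → P (suc i) ≈ - moment c k
  P≈moment i k i+k = begin
    P (suc i)                                ≈⟨ ≈-reflexive (indicator-coefficient roots i k i+k) ⟩
    - total (λ r → (+ r) ^ k) roots
      ≈⟨ ≈-reflexive (≡.cong -_ (total-multiset (λ r → (+ r) ^ k) values p)) ⟩
    - ∑ p (λ x → + values x * (+ x) ^ k)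
      ≈⟨ -‿cong (∑-≈ p (λ x → *-cong (values≈horner x) (≈-refl {(+ x) ^ k}))) ⟩
    - moment c k                             ∎
    where open SetoidReasoning setoid

  P-top : P d ≈ + a
  -- The coefficient at d pairs with the moment of exponent q - d, which is again d; the two minus
  -- signs cancel.
  P-top = ≈-trans (P≈moment e d ≡.refl)
    (≈-trans (-‿cong (moment-top d c d ≡.refl)) (≈-reflexive (ℤₚ.neg-involutive (+ a))))

  δP : Degree≤ d P
  δP (suc i) d<i with suc i ℕₚ.<? p
  ... | no  i≮p = indicator-high roots (suc i) (ℕₚ.≮⇒≥ i≮p)
  -- An index above d leaves a weight exponent below q - d, too small for the d + 1 coefficients to
  -- reach exponent q.
  ... | yes (s≤s i≤q) = ≈-trans (P≈moment i (q ∸ suc i) i+k)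
    (-‿cong (moment-low (suc d) c (q ∸ suc i)
      (ℕₚ.≤-trans (ℕₚ.+-monoˡ-≤ (q ∸ suc i) d<i) (ℕₚ.≤-reflexive i+k))))
    where
    i+k : suc i ℕ.+ (q ∸ suc i) ≡ q
    i+k = ℕₚ.m+[n∸m]≡n i≤q

  distinct-residues : ∀ {x y} → x < y → y < p → ¬ + y ≈ + x
  distinct-residues {x} x<y y<p y≈x with ℕₚ.m≤n⇒∃[o]m+o≡n x<y
  ... | k , ≡.refl = small≉0 k (ℕₚ.≤-<-trans (s≤s (ℕₚ.m≤n+m k x)) y<p)
    (≈-trans (≈-reflexive (eq (+ x) (+ k))) (≈-trans (+-cong y≈x (≈-refl { - + x})) (≈-reflexive (ℤₚ.+-inverseʳ (+ x)))))
    where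
    eq : ∀ x k → 1ℤ + k ≡ (1ℤ + (x + k)) - x
    eq = solve-∀

  residue-unique : ∀ {x y} → x < p → y < p → + x ≈ + y → x ≡ y
  residue-unique {x} {y} x<p y<p x≈y with ℕₚ.<-cmp x y
  ... | tri< x<y _ _ = contradiction (≈-sym x≈y) (distinct-residues x<y y<p)
  ... | tri≈ _ x≡y _ = x≡y
  ... | tri> _ _ y<x = contradiction x≈y (distinct-residues y<x x<p)

  P-top≉0 : ¬ P d ≈ 0ℤ
  P-top≉0 P≈0 = c≢0 (residue-unique (c<p (fromℕ d)) (s≤s z≤n) (≈-trans (≈-sym P-top) P≈0))

  -- With k = 2 a² the resultant is (4 a² - 1)(2 a² - 2); it is split into linear factors, with a
  -- factor 2 set apart to be cancelled.
  factored : (+ 2 * + a - 1ℤ) * ((+ 2 * + a + 1ℤ) * (+ 2 * ((+ a - 1ℤ) * (+ a + 1ℤ)))) ≈ 0ℤ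
  factored = begin
    (+ 2 * + a - 1ℤ) * ((+ 2 * + a + 1ℤ) * (+ 2 * ((+ a - 1ℤ) * (+ a + 1ℤ)))) ≈⟨ ≈-reflexive (eq (+ a)) ⟩
    (+ 2 * (+ 2 * (+ a * + a)) - 1ℤ) * (+ 2 * (+ a * + a) - + 2)                ≈⟨ quartic-cong (≈-sym P-top) ⟩
    (+ 2 * (+ 2 * (P d * P d)) - 1ℤ) * (+ 2 * (P d * P d) - + 2)
      ≈⟨ leading-coefficient-equation F P δF F-monic δP (log-derivative roots) P-top≉0 ⟩
    0ℤ ∎
    where
    open SetoidReasoning setoid
    eq : ∀ a → (+ 2 * a - 1ℤ) * ((+ 2 * a + 1ℤ) * (+ 2 * ((a - 1ℤ) * (a + 1ℤ)))) ≡
               (+ 2 * (+ 2 * (a * a)) - 1ℤ) * (+ 2 * (a * a) - + 2)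
    eq = solve-∀
    quartic-cong : ∀ {x y} → x ≈ y →
      (+ 2 * (+ 2 * (x * x)) - 1ℤ) * (+ 2 * (x * x) - + 2) ≈ (+ 2 * (+ 2 * (y * y)) - 1ℤ) * (+ 2 * (y * y) - + 2)
    quartic-cong x≈y = *-cong
      (+-cong (*-cong (≈-refl {+ 2}) (*-cong (≈-refl {+ 2}) (*-cong x≈y x≈y))) (≈-refl { - 1ℤ}))
      (+-cong (*-cong (≈-refl {+ 2}) (*-cong x≈y x≈y)) (≈-refl { - + 2}))

  difference≈0 : ∀ {x y z} → z ≈ 0ℤ → z ≡ x - y → x ≈ y
  difference≈0 {x} {y} z≈0 z≡ = ≈-trans (≈-reflexive (eq x y))
    (≈-trans (+-cong (≈-trans (≈-reflexive (≡.sym z≡)) z≈0) (≈-refl {y})) (≈-reflexive (ℤₚ.+-identityˡ y)))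
    where
    eq : ∀ x y → x ≡ (x - y) + y
    eq = solve-∀

  2≉0 : ¬ + 2 ≈ 0ℤ
  2≉0 = small≉0 1 (s≤s (s≤s (ℕₚ.≤-trans (s≤s z≤n) (ℕₚ.m≤n+m d e))))

  half : ∀ {x y} → x < p → y < p → + 2 * + x ≈ + 2 * + y → x ≡ y
  half {x} {y} x<p y<p e = residue-unique x<p y<p (difference≈0
    (cancel-nonzero (+ 2) 2≉0 (≈-trans (≈-reflexive (eq (+ x) (+ y)))
      (≈-trans (+-cong e (≈-refl { - (+ 2 * + y)})) (≈-reflexive (ℤₚ.+-inverseʳ (+ 2 * + y))))))
    ≡.refl)
    where
    eq : ∀ x y → + 2 * (x - y) ≡ + 2 * x - + 2 * y
    eq = solve-∀

  a<p : a < p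
  a<p = c<p (fromℕ d)

  q≈-1 : + q ≈ - 1ℤ
  q≈-1 = difference≈0 modulus≈0 (≡.cong +_ (ℕₚ.+-comm 1 q))

  d<p : d < p
  d<p = s≤s (ℕₚ.m≤m+n d d)

  1+d<p : suc d < p
  1+d<p = s≤s (ℕₚ.m<m+n d (s≤s z≤n))

  2a≈1 : + 2 * + a - 1ℤ ≈ 0ℤ → a ≡ suc d
  -- The inverse of 2 is d + 1, because 1 is congruent to p + 1 = 2(d+1); this residue is -(p-1)/2.
  2a≈1 e = half a<p 1+d<p (≈-trans (difference≈0 e ≡.refl)
    (≈-trans (+-cong (≈-sym modulus≈0) (≈-refl {1ℤ})) (≈-reflexive (eq (+ d)))))
    where
    eq : ∀ d → (1ℤ + (d + d)) + 1ℤ ≡ + 2 * (1ℤ + d)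
    eq = solve-∀

  2a≈-1 : + 2 * + a + 1ℤ ≈ 0ℤ → a ≡ d
  -- Here -1 is congruent to p - 1 = 2 d, which identifies the residue as (p-1)/2.
  2a≈-1 e = half a<p d<p (≈-trans (difference≈0 { + 2 * + a} { - 1ℤ} e ≡.refl)
    (≈-trans (≈-sym q≈-1) (≈-reflexive (eq (+ d)))))
    where
    eq : ∀ d → d + d ≡ + 2 * d
    eq = solve-∀

  a≈1 : + a - 1ℤ ≈ 0ℤ → a ≡ 1
  a≈1 e = residue-unique a<p (s≤s (s≤s z≤n)) (difference≈0 e ≡.refl)

  a≈-1 : + a + 1ℤ ≈ 0ℤ → a ≡ q
  a≈-1 e = residue-unique a<p (ℕₚ.n<1+n q) (≈-trans (difference≈0 { + a} { - 1ℤ} e ≡.refl) (≈-sym q≈-1))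

  quartic-roots : ∀ x → (+ 2 * x - 1ℤ) * ((+ 2 * x + 1ℤ) * (+ 2 * ((x - 1ℤ) * (x + 1ℤ)))) ≈ 0ℤ →
    x - 1ℤ ≈ 0ℤ ⊎ x + 1ℤ ≈ 0ℤ ⊎ + 2 * x + 1ℤ ≈ 0ℤ ⊎ + 2 * x - 1ℤ ≈ 0ℤ
  quartic-roots x = product (+ 2 * x - 1ℤ) (+ 2 * x + 1ℤ) (x - 1ℤ) (x + 1ℤ)
    where
    product : ∀ u v y z → u * (v * (+ 2 * (y * z))) ≈ 0ℤ → y ≈ 0ℤ ⊎ z ≈ 0ℤ ⊎ v ≈ 0ℤ ⊎ u ≈ 0ℤ
    product u v y z e with no-zero-divisors u (v * (+ 2 * (y * z))) e
    ... | inj₁ u≈0 = inj₂ (inj₂ (inj₂ u≈0))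
    ... | inj₂ e′ with no-zero-divisors v (+ 2 * (y * z)) e′
    ...   | inj₁ v≈0 = inj₂ (inj₂ (inj₁ v≈0))
    ...   | inj₂ e″ with no-zero-divisors y z (cancel-nonzero (+ 2) {y * z} 2≉0 e″)
    ...     | inj₁ y≈0 = inj₁ y≈0
    ...     | inj₂ z≈0 = inj₂ (inj₁ z≈0)

  classification : a ≡ 1 ⊎ a ≡ q ⊎ a ≡ d ⊎ a ≡ suc d
  classification = Sum.map a≈1 (Sum.map a≈-1 (Sum.map 2a≈-1 2a≈1)) (quartic-roots (+ a) factored)

leading-coefficient : (p d : ℕ) (pr : Prime p) → p ≡ suc (d ℕ.+ d) → 0 < d → (c : Fin (suc d) → ℕ) →
  (∀ i → c i < p) → c (fromℕ d) ≢ 0 → valueSum p {{prime⇒nonZero pr}} c ≡ p →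
  let a = c (fromℕ d) in a ≡ 1 ⊎ a ≡ p ∸ 1 ⊎ a ≡ d ⊎ a ≡ p ∸ d
leading-coefficient .(suc (suc e ℕ.+ suc e)) (suc e) pr ≡.refl 0<d c c<p c≢0 value-sum =
  Sum.map₂ (Sum.map₂ (Sum.map₂ (λ a≡ → ≡.trans a≡ (≡.sym (ℕₚ.m+n∸n≡m (suc (suc e)) (suc e))))))
    (LeadingCoefficient.classification e pr c c<p c≢0 value-sum)

odd-prime : ∀ p → Prime p → 2 < p → p ≡ suc ((p ∸ 1) / 2 ℕ.+ (p ∸ 1) / 2)
odd-prime (suc q) pr 2<p with q % 2 | m%n<n q 2 | m≡m%n+[m/n]*n q 2
... | 0 | _ | q≡ = ≡.cong suc (≡.trans q≡ (eq (q / 2)))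
  where
  eq : ∀ n → n ℕ.* 2 ≡ n ℕ.+ n
  eq = ℕ-solve-∀
-- An odd q would make p = q + 1 divisible by 2, hence equal to 2.
... | 1 | _ | q≡ with prime⇒irreducible pr (ℕᵈ.divides (suc (q / 2)) (≡.cong suc q≡))
...   | inj₁ ()
...   | inj₂ ≡.refl = contradiction 2<p (ℕₚ.<-irrefl ≡.refl)
odd-prime (suc q) pr 2<p | suc (suc _) | s≤s (s≤s ()) | _

theorem3p5 : (p : ℕ) → (pr : Prime p) → 7408848 < p →
    (c : Fin (suc ((p ∸ 1) / 2)) → ℕ) →
    (∀ i → c i < p) →
    c (fromℕ ((p ∸ 1) / 2)) ≢ 0 →
    valueSum p {{prime⇒nonZero pr}} c ≡ p →
    let a = c (fromℕ ((p ∸ 1) / 2)) in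
    (a ≡ 1) ⊎ (a ≡ p ∸ 1) ⊎ (a ≡ (p ∸ 1) / 2) ⊎ (a ≡ p ∸ ((p ∸ 1) / 2))
theorem3p5 p pr large = leading-coefficient p ((p ∸ 1) / 2) pr p≡ (positive ((p ∸ 1) / 2) p≡)
  where
  2<p : 2 < p
  2<p = ℕₚ.<-trans (s≤s (s≤s (s≤s z≤n))) large
  p≡ : p ≡ suc ((p ∸ 1) / 2 ℕ.+ (p ∸ 1) / 2)
  p≡ = odd-prime p pr 2<p
  positive : ∀ d → p ≡ suc (d ℕ.+ d) → 0 < d
  positive zero    p≡1 = contradiction (≡.subst (2 <_) p≡1 2<p) λ { (s≤s ()) }
  positive (suc _) _   = s≤s z≤n
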